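{- For $0\le k\le (n-1)/2$ we have \[ \gamma_{n,k}(q):=\sum_{\sigma\in \mathrm{DD}_{n,k}}q^{2(31\text{ - }2)\sigma+(2\text{ - }13)\sigma} =\sum_{\sigma\in \mathrm{DE}^*_{n,k}}q^{\mathsf{inv}\,\sigma-\mathsf{exc}\,\sigma} =\sum_{\sigma\in \mathrm{SDE}_{n,k}}q^{\mathsf{inv}\,\sigma-\mathsf{exc}\,\sigma}. \]
   Context: For $\sigma\in\mathfrak{S}_n$: $\mathsf{des}\,\sigma$ is the number of $i\in[n-1]$ with $\sigma(i)>\sigma(i+1)$; $\mathsf{exc}\,\sigma$ is the number of $i$ with $\sigma(i)>i$; $\mathsf{inv}\,\sigma$ is the number of inversions; with convention $\sigma(0)=\sigma(n+1)=0$, $\mathsf{dd}\,\sigma$ is the number of double descents, i.e. values $\sigma(i)$ ($1\le i\le n$) with $\sigma(i-1)>\sigma(i)>\sigma(i+1)$. The vincular pattern statistics are $(31\text{ - }2)\sigma=\#\{(i,j): i+1<j\le n,\ \sigma(i+1)<\sigma(j)<\sigma(i)\}$ and $(2\text{ - }13)\sigma=\#\{(i,j): j<i<n,\ \sigma(i)<\sigma(j)<\sigma(i+1)\}$. The star companion of $\sigma\in\mathfrak{S}_n$ is the permutation $\sigma^*$ of $\{0,1,\ldots,n\}$ with $\sigma^*(0)=n$ and $\sigma^*(i)=\sigma(i)-1$ for $i\in[n]$. Let $\mathsf{cda}^*\sigma=\#\{i\in[n-1]: (\sigma^*)^{ -1}(i)<i<\sigma^*(i)\}$ and $\mathsf{fix}^*\sigma=\#\{i\in[n-1]: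 \sigma^*(i)=i\}$. Let $\mathsf{scda}\,\sigma=\#\{i\in[n-1]: i<\sigma(i)\ \text{and}\ i+1>\sigma^{ -1}(i+1)\}$. Define $\mathrm{DD}_{n,k}=\{\sigma\in\mathfrak{S}_n:\mathsf{des}\,\sigma=k,\ \mathsf{dd}\,\sigma=0\}$, $\mathrm{DE}^*_{n,k}=\{\sigma\in\mathfrak{S}_n:\mathsf{exc}\,\sigma=k,\ \mathsf{cda}^*\sigma+\mathsf{fix}^*\sigma=0\}$, and $\mathrm{SDE}_{n,k}=\{\sigma\in\mathfrak{S}_n:\mathsf{exc}\,\sigma=k,\ \mathsf{scda}\,\sigma=0\}$. -}

module Defs where

open import Algebra.Bundles using (CommutativeSemiring)
open import Data.Fin.Base using (Fin; zero; suc; toℕ; fromℕ; fromℕ<; punchIn; inject₁)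
open import Data.Fin.Permutation
  using (Permutation′; _⟨$⟩ʳ_; _⟨$⟩ˡ_; _≈_; id; flip; insert; remove; insert-remove; insert-punchIn)
open import Data.Fin.Properties using (punchIn-injective)
open import Data.List.Base
  using (List; []; _∷_; map; concatMap; filter; length; foldr; upTo; allFin; cartesianProduct)
open import Data.List.Membership.Propositional.Properties using (∈-allFin)
open import Data.List.Relation.Unary.All as All using (All; []; _∷_)
open import Data.List.Relation.Unary.AllPairs as AllPairs using (AllPairs; []; _∷_)
open import Data.List.Relation.Unary.Any as Any using (Any; here)
open import Data.List.Relation.Unary.Unique.Propositional.Properties using (allFin⁺)
import Data.List.Relation.Unary.All.Properties as All
import Data.List.Relation.Unary.AllPairs.Properties as AllPairs
import Data.List.Relation.Unary.Any.Properties as Any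
open import Data.Nat.Base using (ℕ; zero; suc; _+_; _*_; _∸_)
open import Data.Nat.Properties using (_≟_; _<?_; _≤?_)
open import Data.Product.Base using (_×_; _,_)
open import Function.Base using (_∘_)
open import Relation.Binary.PropositionalEquality.Core using (_≡_; refl; sym; trans; cong)
open import Relation.Nullary.Decidable.Core using (yes; no; _×-dec_)
open import Relation.Nullary.Negation.Core using (¬_)
open import Relation.Unary using (Pred; Decidable)

-- Every permutation of Fin n occurs exactly once up to pointwise equality:
-- see perms-complete and perms-distinct below.
perms : ∀ n → List (Permutation′ n)
perms zero    = id ∷ []
perms (suc n) = concatMap (λ j → map (insert zero j) (perms n)) (allFin (suc n))

-- The one-line word, with 1-based positions and values and with the
-- boundary convention σ(0) = σ(n+1) = 0.
word : ∀ {n} → Permutation′ n → ℕ → ℕ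
word σ zero = 0
word {n} σ (suc i) with i <? n
... | yes i<n = suc (toℕ (σ ⟨$⟩ʳ fromℕ< i<n))
... | no  _   = 0

-- The integers 1, …, m.
[1⋯_] : ℕ → List ℕ
[1⋯ m ] = map suc (upTo m)

count : ∀ {a p} {A : Set a} {P : Pred A p} → Decidable P → List A → ℕ
count P? xs = length (filter P? xs)

module _ {n : ℕ} (σ : Permutation′ n) where

  private
    s s⁻¹ : ℕ → ℕ
    s   = word σ
    s⁻¹ = word (flip σ)

    positions : List ℕ
    positions = [1⋯ n ]

    pairs : List (ℕ × ℕ)
    pairs = cartesianProduct positions positions

  des : ℕ
  des = count (λ i → s (i + 1) <? s i) [1⋯ n ∸ 1 ]

  exc : ℕ
  exc = count (λ i → i <? s i) positions

  inv : ℕ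
  inv = count (λ (i , j) → (i <? j) ×-dec (s j <? s i)) pairs

  dd : ℕ
  dd = count (λ i → (s i <? s (i ∸ 1)) ×-dec (s (i + 1) <? s i)) positions

  pat31-2 : ℕ
  pat31-2 = count (λ (i , j) → (i + 1 <? j) ×-dec (s (i + 1) <? s j) ×-dec (s j <? s i)) pairs

  pat2-13 : ℕ
  pat2-13 = count (λ (i , j) → (j <? i) ×-dec (i <? n) ×-dec (s i <? s j) ×-dec (s j <? s (i + 1))) pairs

  scda : ℕ
  scda = count (λ i → (i <? s i) ×-dec (s⁻¹ (i + 1) <? i + 1)) [1⋯ n ∸ 1 ]

  -- The star companion, a permutation of {0,…,n}.  Since Fin n is 0-based,
  -- σ(i) − 1 for the 1-based σ is the value of the Fin permutation at the
  -- (i−1)-st index: see star-zero and star-suc below.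
  star : Permutation′ (suc n)
  star = insert zero (fromℕ n) σ

  cda* : ℕ
  cda* = count
    (λ i → ((1 ≤? toℕ i) ×-dec (toℕ i <? n))
           ×-dec (toℕ (star ⟨$⟩ˡ i) <? toℕ i) ×-dec (toℕ i <? toℕ (star ⟨$⟩ʳ i)))
    (allFin (suc n))

  fix* : ℕ
  fix* = count
    (λ i → ((1 ≤? toℕ i) ×-dec (toℕ i <? n)) ×-dec (toℕ (star ⟨$⟩ʳ i) ≟ toℕ i))
    (allFin (suc n))

DD : ∀ n → ℕ → List (Permutation′ n)
DD n k = filter (λ σ → (des σ ≟ k) ×-dec (dd σ ≟ 0)) (perms n)

DE* : ∀ n → ℕ → List (Permutation′ n)
DE* n k = filter (λ σ → (exc σ ≟ k) ×-dec (cda* σ + fix* σ ≟ 0)) (perms n)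

SDE : ∀ n → ℕ → List (Permutation′ n)
SDE n k = filter (λ σ → (exc σ ≟ k) ×-dec (scda σ ≟ 0)) (perms n)

-- A polynomial in q with coefficients in ℕ is read as an expression in an
-- arbitrary element q of an arbitrary commutative semiring; taking q to be the
-- indeterminate of ℕ[q] gives back equality of polynomials.
module Enumerators {c ℓ} (R : CommutativeSemiring c ℓ) (q : CommutativeSemiring.Carrier R) where

  private
    module R = CommutativeSemiring R
  open import Algebra.Properties.Semiring.Exp R.semiring using (_^_)

  ∑q^ : ∀ {a} {A : Set a} → (A → ℕ) → List A → R.Carrier
  ∑q^ stat xs = foldr R._+_ R.0# (map (λ x → q ^ stat x) xs)

  γ : ℕ → ℕ → R.Carrier
  γ n k = ∑q^ (λ σ → 2 * pat31-2 σ + pat2-13 σ) (DD n k)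

-- Truncated subtraction loses nothing: exc σ ≤ inv σ, because for each
-- excedance i the values σ(j) with j > i cannot all exceed i, so that i is the
-- left end of some inversion.
inv-exc : ∀ {n} → Permutation′ n → ℕ
inv-exc σ = inv σ ∸ exc σ

star-zero : ∀ {n} (σ : Permutation′ n) → star σ ⟨$⟩ʳ zero ≡ fromℕ n
star-zero σ = refl

star-suc : ∀ {n} (σ : Permutation′ n) i → star σ ⟨$⟩ʳ suc i ≡ inject₁ (σ ⟨$⟩ʳ i)
star-suc {n} σ i = trans (insert-punchIn zero (fromℕ n) σ i) (punchIn-fromℕ (σ ⟨$⟩ʳ i))
  where
  punchIn-fromℕ : ∀ {m} (j : Fin m) → punchIn (fromℕ m) j ≡ inject₁ j
  punchIn-fromℕ zero    = refl
  punchIn-fromℕ (suc j) = cong suc (punchIn-fromℕ j)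

private
  insert-cong : ∀ {n} j {σ τ : Permutation′ n} → σ ≈ τ → insert zero j σ ≈ insert zero j τ
  insert-cong j σ≈τ zero    = refl
  insert-cong j σ≈τ (suc i) = cong (punchIn j) (σ≈τ i)

  insert-injective : ∀ {n} j {σ τ : Permutation′ n} → insert zero j σ ≈ insert zero j τ → σ ≈ τ
  insert-injective j eq i = punchIn-injective j _ _ (eq (suc i))

perms-complete : ∀ n (σ : Permutation′ n) → Any (σ ≈_) (perms n)
perms-complete zero    σ = here λ ()
perms-complete (suc n) σ =
  Any.concat⁺ (Any.map⁺ (Any.map (λ { refl → Any.map⁺ (Any.map extend (perms-complete n (remove zero σ))) })
    (∈-allFin (σ ⟨$⟩ʳ zero))))
  where
  extend : ∀ {τ} → remove zero σ ≈ τ → σ ≈ insert zero (σ ⟨$⟩ʳ zero) τ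
  extend {τ} eq i = trans (sym (insert-remove zero σ i))
    (insert-cong (σ ⟨$⟩ʳ zero) {remove zero σ} {τ} eq i)

perms-distinct : ∀ n → AllPairs (λ σ τ → ¬ σ ≈ τ) (perms n)
perms-distinct zero    = [] ∷ []
perms-distinct (suc n) = AllPairs.concat⁺
  (All.map⁺ (All.universal
    (λ j → AllPairs.map⁺ (AllPairs.map (λ {σ} {τ} σ≉τ → σ≉τ ∘ insert-injective j {σ} {τ}) (perms-distinct n)))
    (allFin (suc n))))
  (AllPairs.map⁺ (AllPairs.map
    (λ i≢j → All.map⁺ (All.universal (λ _ → All.map⁺ (All.universal (λ _ eq → i≢j (eq zero)) (perms n))) (perms n)))
    (allFin⁺ (suc n))))

{-# OPTIONS --safe #-}
-- Both sides are a sum over the same weighted Motzkin paths, in which every step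
-- starting at height u weighs w u = q^u + q^(u+1) + … + q^(2u).
--
-- The words of DD are read by inserting the letters in decreasing order.  The
-- positions reserved for smaller letters separate a word into blocks; the next
-- smaller letter x goes to one of h + 1 places, where it becomes a valley (one
-- block more), a double ascent or a peak (one block less), and it takes part, as
-- the "2", in g patterns 31-2 and h − g patterns 2-13, for g = 0, …, h.
--
-- For the excedances, position i is read together with value i + 1 and the height
-- is the number of excedances (j, σ(j)) with j ≤ i < σ(j).  Both DE* and SDE say
-- that no i is an excedance position while i + 1 is an excedance value.  Removing
-- a pair completed at step i leaves a permutation of the same kind and lowers
-- inv − exc by u + v for some v = 0, …, u, which gives a factor w u.
module Submission where

open import Defs
open import Algebra.Bundles using (CommutativeSemiring)
open import Data.Nat.Base using (ℕ; _*_; _<_)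
open import Data.Product.Base using (_×_; _,_)
open import Relation.Binary.PropositionalEquality.Core using (cong)

-- No bijection is built: both sums are shown to satisfy the recurrence of `motzkin`. On the word
-- side, a removed letter leaves behind places where smaller letters stood, so the induction runs
-- over all pairs of a word and a set of bars. A bar is a letter 0 and compares with larger letters
-- just as the lowest letter that will fill it does. Hence the patterns whose 2 is x can be counted
-- once and for all when x is inserted: each bar left of x gives a 31-2, each bar right of x a 2-13.
-- With h bars afterwards, g of them to the left, the exponent grows by 2g + (h - g) = h + g; this
-- is the origin of `w` and of the coefficient 2. On the excedance side every removed pair (p, v)
-- has only larger values to the left of p, so that it takes part in exactly p + v inversions. The
-- obstacle is the enumeration: `perms` inserts at the first position, while the recurrences insert
-- at a prescribed position or with a prescribed value. As permutations are compared pointwise, sums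
-- are reindexed over classes of `≈`, and every summand has to respect `≈`.

module Permutations where

  open import Data.Fin.Base using (Fin; zero; suc; toℕ; fromℕ<; punchIn; punchOut)
  open import Data.Fin.Permutation
    using (Permutation′; _⟨$⟩ʳ_; _⟨$⟩ˡ_; flip; insert; inverseˡ; inverseʳ; insert-punchIn)
  open import Data.Fin.Properties
    using (toℕ<n; toℕ-injective; toℕ-inject₁; toℕ-fromℕ; toℕ-fromℕ<; fromℕ<-toℕ; punchIn-punchOut)
  import Data.Fin.Properties as Fin
  open import Data.List.Base using (List; []; _∷_; _++_; map; length; filter; allFin; applyUpTo; cartesianProduct)
  open import Data.List.Membership.Propositional using (_∈_; lose)
  open import Data.List.Membership.Propositional.Properties using (∈-map⁺; ∈-map⁻; ∈-upTo⁺; ∈-upTo⁻; ∈-allFin)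
  open import Data.List.Properties using (map-upTo; filter-++; length-++; filter-none; filter-some; filter-≐)
  import Data.List.Relation.Unary.All as All
  open import Data.Nat.Base using (zero; suc; _+_; _∸_; _≤_; z≤n; s≤s)
  open import Data.Nat.Properties
  open import Data.Sum.Base using (_⊎_; inj₁; inj₂; [_,_]′)
  open import Function.Base using (_∘_)
  open import Relation.Binary.Definitions using (tri<; tri≈; tri>)
  open import Relation.Binary.PropositionalEquality
  open import Relation.Nullary.Decidable.Core using (Dec; yes; no; _×-dec_; _→-dec_)
  open import Relation.Nullary.Negation.Core using (¬_; contradiction)
  open import Relation.Unary using (Pred; Decidable)
  open import Algebra.Properties.CommutativeMonoid.Sum +-0-commutativeMonoid
    using (sum; sum-cong-≗; sum-remove; sum-permute; sum-replicate-zero; ∑-distrib-+)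

  -- Indicators, and the statistics as sums over `Fin n`.

  𝟙 : ∀ {p} {P : Set p} → Dec P → ℕ
  𝟙 (yes _) = 1
  𝟙 (no _)  = 0

  𝟙-cong : ∀ {p q} {P : Set p} {Q : Set q} (P? : Dec P) (Q? : Dec Q) → (P → Q) → (Q → P) → 𝟙 P? ≡ 𝟙 Q?
  𝟙-cong (yes p) (yes q) f g = refl
  𝟙-cong (yes p) (no ¬q) f g = contradiction (f p) ¬q
  𝟙-cong (no ¬p) (yes q) f g = contradiction (g q) ¬p
  𝟙-cong (no ¬p) (no ¬q) f g = refl

  𝟙-yes : ∀ {p} {P : Set p} (P? : Dec P) → P → 𝟙 P? ≡ 1
  𝟙-yes (yes _) p = refl
  𝟙-yes (no ¬p) p = contradiction p ¬p

  𝟙-no : ∀ {p} {P : Set p} (P? : Dec P) → ¬ P → 𝟙 P? ≡ 0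
  𝟙-no (yes p) ¬p = contradiction p ¬p
  𝟙-no (no _)  ¬p = refl

  module _ {a p} {A : Set a} {P : Pred A p} (P? : Decidable P) where

    count-∷ : ∀ x xs → count P? (x ∷ xs) ≡ 𝟙 (P? x) + count P? xs
    count-∷ x xs with P? x
    ... | yes _ = refl
    ... | no  _ = refl

    count-++ : ∀ xs ys → count P? (xs ++ ys) ≡ count P? xs + count P? ys
    count-++ xs ys = trans (cong length (filter-++ P? xs ys)) (length-++ (filter P? xs))

    count-applyUpTo : ∀ (f : ℕ → A) n → count P? (applyUpTo f n) ≡ sum {n} (λ i → 𝟙 (P? (f (toℕ i))))
    count-applyUpTo f zero    = refl
    count-applyUpTo f (suc n) =
      trans (count-∷ (f 0) (applyUpTo (f ∘ suc) n)) (cong (𝟙 (P? (f 0)) +_) (count-applyUpTo (f ∘ suc) n))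

  count-map : ∀ {a b p} {A : Set a} {B : Set b} {P : Pred A p} (P? : Decidable P) (f : B → A) xs →
    count P? (map f xs) ≡ count (P? ∘ f) xs
  count-map P? f []       = refl
  count-map P? f (x ∷ xs) = trans (count-∷ P? (f x) (map f xs))
    (trans (cong (𝟙 (P? (f x)) +_) (count-map P? f xs)) (sym (count-∷ (P? ∘ f) x xs)))

  count-[1⋯] : ∀ {p q} {P : Pred ℕ p} (P? : Decidable P) n
    {Q : Fin n → Set q} (Q? : ∀ i → Dec (Q i)) →
    (∀ i → P (suc (toℕ i)) → Q i) → (∀ i → Q i → P (suc (toℕ i))) →
    count P? [1⋯ n ] ≡ sum (λ i → 𝟙 (Q? i))
  count-[1⋯] P? n Q? to from =
    trans (trans (cong (count P?) (map-upTo suc n)) (count-applyUpTo P? suc n))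
      (sum-cong-≗ λ i → 𝟙-cong (P? (suc (toℕ i))) (Q? i) (to i) (from i))

  count-pairs : ∀ {p q} {P : Pred (ℕ × ℕ) p} (P? : Decidable P) n
    {Q : Fin n → Fin n → Set q} (Q? : ∀ i j → Dec (Q i j)) →
    (∀ i j → P (suc (toℕ i) , suc (toℕ j)) → Q i j) → (∀ i j → Q i j → P (suc (toℕ i) , suc (toℕ j))) →
    count P? (cartesianProduct [1⋯ n ] [1⋯ n ]) ≡ sum (λ i → sum (λ j → 𝟙 (Q? i j)))
  count-pairs P? n Q? to from =
    trans (trans (cong (λ xs → count P? (cartesianProduct xs [1⋯ n ])) (map-upTo suc n)) (rows suc n))
      (sum-cong-≗ λ i → count-[1⋯] (P? ∘ (suc (toℕ i) ,_)) n (Q? i) (to i) (from i))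
    where
    rows : ∀ f m → count P? (cartesianProduct (applyUpTo f m) [1⋯ n ]) ≡
      sum {m} (λ i → count (P? ∘ (f (toℕ i) ,_)) [1⋯ n ])
    rows f zero    = refl
    rows f (suc m) = trans (count-++ P? (map (f 0 ,_) [1⋯ n ]) _)
      (cong₂ _+_ (count-map P? (f 0 ,_) [1⋯ n ]) (rows (f ∘ suc) m))

  val : ∀ {n} → Permutation′ n → Fin n → ℕ
  val σ i = toℕ (σ ⟨$⟩ʳ i)

  word-suc : ∀ {n} (σ : Permutation′ n) i → word σ (suc (toℕ i)) ≡ suc (val σ i)
  word-suc {n} σ i with toℕ i <? n
  ... | yes p = cong (suc ∘ val σ) (fromℕ<-toℕ i p)
  ... | no ¬p = contradiction (toℕ<n i) ¬p

  word-end : ∀ {n} (σ : Permutation′ n) → word σ (suc n) ≡ 0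
  word-end {n} σ with n <? n
  ... | yes p = contradiction p (<-irrefl refl)
  ... | no ¬p = refl

  exc? : ∀ {n} (σ : Permutation′ n) i → Dec (toℕ i < val σ i)
  exc? σ i = toℕ i <? val σ i

  exc-sum : ∀ {n} (σ : Permutation′ n) → exc σ ≡ sum (λ i → 𝟙 (exc? σ i))
  exc-sum {n} σ = count-[1⋯] _ n (exc? σ)
    (λ i p → ≤-pred (subst (suc (toℕ i) <_) (word-suc σ i) p))
    (λ i p → subst (suc (toℕ i) <_) (sym (word-suc σ i)) (s≤s p))

  inv? : ∀ {n} (σ : Permutation′ n) i j → Dec (toℕ i < toℕ j × val σ j < val σ i)
  inv? σ i j = (toℕ i <? toℕ j) ×-dec (val σ j <? val σ i)

  inv-sum : ∀ {n} (σ : Permutation′ n) → inv σ ≡ sum (λ i → sum (λ j → 𝟙 (inv? σ i j)))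
  inv-sum {n} σ = count-pairs _ n (inv? σ)
    (λ i j (p , q) → ≤-pred p , ≤-pred (subst₂ _<_ (word-suc σ j) (word-suc σ i) q))
    (λ i j (p , q) → s≤s p , subst₂ _<_ (sym (word-suc σ j)) (sym (word-suc σ i)) (s≤s q))

  -- Inversions and excedances under insertion of a pair.

  insert-at : ∀ {n} p v (τ : Permutation′ n) → insert p v τ ⟨$⟩ʳ p ≡ v
  insert-at p v τ with p Fin.≟ p
  ... | yes _  = refl
  ... | no p≢p = contradiction refl p≢p

  -- The graph of punchIn v on natural numbers.
  data PunchIn (v a : ℕ) : ℕ → Set where
    below : a < v → PunchIn v a a
    above : v ≤ a → PunchIn v a (suc a)

  punchIn-view : ∀ {n} (v : Fin (suc n)) a → PunchIn (toℕ v) (toℕ a) (toℕ (punchIn v a))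
  punchIn-view zero    a       = above z≤n
  punchIn-view (suc v) zero    = below (s≤s z≤n)
  punchIn-view (suc v) (suc a) with toℕ (punchIn v a) | punchIn-view v a
  ... | _ | below a<v = below (s≤s a<v)
  ... | _ | above v≤a = above (s≤s v≤a)

  PunchIn-above : ∀ {v a x} → PunchIn v a x → v ≤ a → x ≡ suc a
  PunchIn-above (below a<v) v≤a = contradiction a<v (≤⇒≯ v≤a)
  PunchIn-above (above _)   v≤a = refl

  PunchIn-below : ∀ {v a x} → PunchIn v a x → a < v → x ≡ a
  PunchIn-below (below _)   a<v = refl
  PunchIn-below (above v≤a) a<v = contradiction a<v (≤⇒≯ v≤a)

  PunchIn-mono : ∀ {v a b x y} → PunchIn v a x → PunchIn v b y → a < b → x < y
  PunchIn-mono (below _)   (below _)   a<b = a<b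
  PunchIn-mono (below _)   (above _)   a<b = m<n⇒m<1+n a<b
  PunchIn-mono (above v≤a) (below b<v) a<b = contradiction (<-≤-trans b<v v≤a) (<-asym a<b)
  PunchIn-mono (above _)   (above _)   a<b = s≤s a<b

  PunchIn-cancel : ∀ {v a b x y} → PunchIn v a x → PunchIn v b y → x < y → a < b
  PunchIn-cancel {a = a} {b} P Q x<y with <-cmp a b
  ... | tri< a<b _ _ = a<b
  ... | tri> _ _ b<a = contradiction (PunchIn-mono Q P b<a) (<-asym x<y)
  ... | tri≈ _ refl _ with P | Q
  ...   | below _ | below _     = x<y
  ...   | below a<v | above v≤a = contradiction a<v (≤⇒≯ v≤a)
  ...   | above v≤a | below a<v = contradiction a<v (≤⇒≯ v≤a)
  ...   | above _ | above _     = contradiction x<y (<-irrefl refl)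

  PunchIn-pred : ∀ {v a x b} → PunchIn v a x → suc b < x → b < a
  PunchIn-pred (below _) lt = <⇒≤ lt
  PunchIn-pred (above _) lt = ≤-pred lt

  val-punchIn : ∀ {n} p v (τ : Permutation′ n) i → PunchIn (toℕ v) (val τ i) (val (insert p v τ) (punchIn p i))
  val-punchIn p v τ i = subst (PunchIn (toℕ v) (val τ i)) (cong toℕ (sym (insert-punchIn p v τ i)))
    (punchIn-view v (τ ⟨$⟩ʳ i))

  val-at : ∀ {n} p v (τ : Permutation′ n) → val (insert p v τ) p ≡ toℕ v
  val-at p v τ = cong toℕ (insert-at p v τ)

  data InsertView {n} (p : Fin (suc n)) : Fin (suc n) → Set where
    at   : InsertView p p
    away : ∀ i → InsertView p (punchIn p i)

  insertView : ∀ {n} (p i : Fin (suc n)) → InsertView p i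
  insertView p i with p Fin.≟ i
  ... | yes refl = at
  ... | no p≢i   = subst (InsertView p) (punchIn-punchOut p≢i) (away (punchOut p≢i))

  sum-below : ∀ n p → p ≤ n → sum {n} (λ i → 𝟙 (toℕ i <? p)) ≡ p
  sum-below zero    zero    z≤n = refl
  sum-below (suc n) zero    z≤n =
    trans (sum-cong-≗ {n} {y = λ _ → 0} λ i → 𝟙-no (suc (toℕ i) <? 0) λ ()) (sum-replicate-zero n)
  sum-below (suc n) (suc p) (s≤s p≤n) =
    cong suc (trans (sum-cong-≗ {n} λ i → 𝟙-cong (suc (toℕ i) <? suc p) (toℕ i <? p) ≤-pred s≤s) (sum-below n p p≤n))

  sum-val-below : ∀ {n} (τ : Permutation′ n) v → v ≤ n → sum (λ i → 𝟙 (val τ i <? v)) ≡ v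
  sum-val-below {n} τ v v≤n = trans (sym (sum-permute (λ i → 𝟙 (toℕ i <? v)) τ)) (sum-below n v v≤n)

  sum-mono : ∀ {n} {f g : Fin n → ℕ} → (∀ i → f i ≤ g i) → sum f ≤ sum g
  sum-mono {zero}  f≤g = z≤n
  sum-mono {suc n} f≤g = +-mono-≤ (f≤g zero) (sum-mono (f≤g ∘ suc))

  -- Among the σ(i) values below σ(i), at most i stand to the left of position i.
  exc≤inv : ∀ {n} (σ : Permutation′ n) → exc σ ≤ inv σ
  exc≤inv {n} σ = subst₂ _≤_ (sym (exc-sum σ)) (sym (inv-sum σ)) (sum-mono row)
    where
    row : ∀ i → 𝟙 (exc? σ i) ≤ sum (λ j → 𝟙 (inv? σ i j))
    row i with exc? σ i
    ... | no _    = z≤n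
    ... | yes i<σi = +-cancelˡ-≤ (toℕ i) 1 (sum (λ j → 𝟙 (inv? σ i j))) (begin
        toℕ i + 1                                ≡⟨ +-comm (toℕ i) 1 ⟩
        suc (toℕ i)                              ≤⟨ i<σi ⟩
        val σ i                                  ≡⟨ sum-val-below σ (val σ i) (<⇒≤ (toℕ<n (σ ⟨$⟩ʳ i))) ⟨
        sum (λ j → 𝟙 (val σ j <? val σ i))       ≤⟨ sum-mono split ⟩
        sum (λ j → 𝟙 (toℕ j <? toℕ i) + 𝟙 (inv? σ i j))
          ≡⟨ ∑-distrib-+ (λ j → 𝟙 (toℕ j <? toℕ i)) (λ j → 𝟙 (inv? σ i j)) ⟩
        sum {n} (λ j → 𝟙 (toℕ j <? toℕ i)) + sum (λ j → 𝟙 (inv? σ i j))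
          ≡⟨ cong (_+ sum (λ j → 𝟙 (inv? σ i j))) (sum-below n (toℕ i) (<⇒≤ (toℕ<n i))) ⟩
        toℕ i + sum (λ j → 𝟙 (inv? σ i j))       ∎)
      where
      open ≤-Reasoning
      split : ∀ j → 𝟙 (val σ j <? val σ i) ≤ 𝟙 (toℕ j <? toℕ i) + 𝟙 (inv? σ i j)
      split j with val σ j <? val σ i
      ... | no _ = z≤n
      ... | yes lt with toℕ j <? toℕ i
      ...   | yes _ = s≤s z≤n
      ...   | no j≮i with toℕ i <? toℕ j
      ...     | yes _ = ≤-refl
      ...     | no i≮j with toℕ-injective (≤-antisym (≮⇒≥ i≮j) (≮⇒≥ j≮i))
      ...       | refl = contradiction lt (<-irrefl refl)

  module _ {n} (p v : Fin (suc n)) (τ : Permutation′ n) (left : ∀ i → toℕ i < toℕ p → toℕ v ≤ val τ i) where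

    private
      σ : Permutation′ (suc n)
      σ = insert p v τ

    -- By `left`, each of the p entries to the left of the new pair ends up above v and forms an
    -- inversion with it. So all v smaller values stand to its right, which gives v more. Old pairs
    -- keep their order because `punchIn` is monotone in positions and in values.
    inv-insert : inv σ ≡ toℕ v + toℕ p + inv τ
    inv-insert = begin
      inv σ                                                        ≡⟨ inv-sum σ ⟩
      sum (λ i → sum (λ j → 𝟙 (inv? σ i j)))                       ≡⟨ sum-remove {n} {p} (λ i → sum (λ j → 𝟙 (inv? σ i j))) ⟩
      sum (λ j → 𝟙 (inv? σ p j)) + sum (λ i → sum (λ j → 𝟙 (inv? σ (punchIn p i) j)))
        ≡⟨ cong₂ _+_ row-p (sum-cong-≗ row) ⟩
      toℕ v + sum (λ i → 𝟙 (toℕ i <? toℕ p) + sum (λ j → 𝟙 (inv? τ i j)))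
        ≡⟨ cong (toℕ v +_) (∑-distrib-+ (λ i → 𝟙 (toℕ i <? toℕ p)) (λ i → sum (λ j → 𝟙 (inv? τ i j)))) ⟩
      toℕ v + (sum {n} (λ i → 𝟙 (toℕ i <? toℕ p)) + sum (λ i → sum (λ j → 𝟙 (inv? τ i j))))
        ≡⟨ cong (toℕ v +_) (cong₂ _+_ (sum-below n (toℕ p) (≤-pred (toℕ<n p))) (sym (inv-sum τ))) ⟩
      toℕ v + (toℕ p + inv τ)                                      ≡⟨ +-assoc (toℕ v) (toℕ p) (inv τ) ⟨
      toℕ v + toℕ p + inv τ                                        ∎
      where
      open ≡-Reasoning
      row-p : sum (λ j → 𝟙 (inv? σ p j)) ≡ toℕ v
      row-p = begin
        sum (λ j → 𝟙 (inv? σ p j))                                 ≡⟨ sum-remove {n} {p} (λ j → 𝟙 (inv? σ p j)) ⟩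
        𝟙 (inv? σ p p) + sum (λ j → 𝟙 (inv? σ p (punchIn p j)))
          ≡⟨ cong₂ _+_ (𝟙-no (inv? σ p p) λ (lt , _) → <-irrefl refl lt)
               (sum-cong-≗ λ j → 𝟙-cong (inv? σ p (punchIn p j)) (val τ j <? toℕ v) (to j) (from j)) ⟩
        sum (λ j → 𝟙 (val τ j <? toℕ v))                           ≡⟨ sum-val-below τ (toℕ v) (≤-pred (toℕ<n v)) ⟩
        toℕ v                                                      ∎
        where
        to : ∀ j → toℕ p < toℕ (punchIn p j) × val σ (punchIn p j) < val σ p → val τ j < toℕ v
        to j (_ , lt) rewrite val-at p v τ with val σ (punchIn p j) | val-punchIn p v τ j
        ... | _ | below τj<v = τj<v
        ... | _ | above v≤τj = contradiction (m<n⇒m<1+n (≤-trans lt v≤τj)) (<-irrefl refl)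
        from : ∀ j → val τ j < toℕ v → toℕ p < toℕ (punchIn p j) × val σ (punchIn p j) < val σ p
        from j τj<v rewrite val-at p v τ | PunchIn-below (val-punchIn p v τ j) τj<v
          | PunchIn-above (punchIn-view p j) (≮⇒≥ λ j<p → ≤⇒≯ (left j j<p) τj<v) =
          s≤s (≮⇒≥ λ j<p → ≤⇒≯ (left j j<p) τj<v) , τj<v
      row : ∀ i → sum (λ j → 𝟙 (inv? σ (punchIn p i) j)) ≡ 𝟙 (toℕ i <? toℕ p) + sum (λ j → 𝟙 (inv? τ i j))
      row i = trans (sum-remove {n} {p} (λ j → 𝟙 (inv? σ (punchIn p i) j)))
        (cong₂ _+_ (𝟙-cong (inv? σ (punchIn p i) p) (toℕ i <? toℕ p) to from)
          (sum-cong-≗ λ j → 𝟙-cong (inv? σ (punchIn p i) (punchIn p j)) (inv? τ i j)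
            (λ (a , b) → PunchIn-cancel (punchIn-view p i) (punchIn-view p j) a
                       , PunchIn-cancel (val-punchIn p v τ j) (val-punchIn p v τ i) b)
            (λ (a , b) → PunchIn-mono (punchIn-view p i) (punchIn-view p j) a
                       , PunchIn-mono (val-punchIn p v τ j) (val-punchIn p v τ i) b)))
        where
        to : toℕ (punchIn p i) < toℕ p × val σ p < val σ (punchIn p i) → toℕ i < toℕ p
        to (lt , _) with toℕ (punchIn p i) | punchIn-view p i
        ... | _ | below i<p = i<p
        ... | _ | above p≤i = contradiction (m<n⇒m<1+n (≤-trans lt p≤i)) (<-irrefl refl)
        from : toℕ i < toℕ p → toℕ (punchIn p i) < toℕ p × val σ p < val σ (punchIn p i)
        from i<p rewrite val-at p v τ | PunchIn-below (punchIn-view p i) i<p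
          | PunchIn-above (val-punchIn p v τ i) (left i i<p) = i<p , s≤s (left i i<p)

    -- An old entry can change its excedance status only if exactly one of its position and value is
    -- shifted. If only the value is shifted, i < p and the entry was an excedance already. If only
    -- the position is shifted, its value is below v and the entry was not an excedance before.
    exc-insert : (∀ i → toℕ i < toℕ p → toℕ i < val τ i) → (∀ i → val τ i < toℕ v → val τ i ≤ toℕ i) →
      exc σ ≡ 𝟙 (toℕ p <? toℕ v) + exc τ
    exc-insert left-exc low-nonexc = begin
      exc σ                                                      ≡⟨ exc-sum σ ⟩
      sum (λ i → 𝟙 (exc? σ i))                                   ≡⟨ sum-remove {n} {p} (λ i → 𝟙 (exc? σ i)) ⟩
      𝟙 (exc? σ p) + sum (λ i → 𝟙 (exc? σ (punchIn p i)))
        ≡⟨ cong₂ _+_ (cong (λ x → 𝟙 (toℕ p <? x)) (val-at p v τ))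
             (sum-cong-≗ λ i → 𝟙-cong (exc? σ (punchIn p i)) (exc? τ i) (to i) (from i)) ⟩
      𝟙 (toℕ p <? toℕ v) + sum (λ i → 𝟙 (exc? τ i))              ≡⟨ cong (𝟙 (toℕ p <? toℕ v) +_) (exc-sum τ) ⟨
      𝟙 (toℕ p <? toℕ v) + exc τ                                 ∎
      where
      open ≡-Reasoning
      to : ∀ i → toℕ (punchIn p i) < val σ (punchIn p i) → toℕ i < val τ i
      to i lt with toℕ (punchIn p i) | punchIn-view p i | val σ (punchIn p i) | val-punchIn p v τ i
      ... | _ | below i<p | _ | _       = left-exc i i<p
      ... | _ | above _   | _ | below _ = <⇒≤ lt
      ... | _ | above _   | _ | above _ = ≤-pred lt
      from : ∀ i → toℕ i < val τ i → toℕ (punchIn p i) < val σ (punchIn p i)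
      from i lt with toℕ (punchIn p i) | punchIn-view p i | val σ (punchIn p i) | val-punchIn p v τ i
      ... | _ | _       | _ | below τi<v = contradiction lt (≤⇒≯ (low-nonexc i τi<v))
      ... | _ | below _ | _ | above _    = m<n⇒m<1+n lt
      ... | _ | above _ | _ | above _    = s≤s lt

  -- The states of the excedance scan and the transitions between them.

  -- Positions and values are 0-based.  Good u (suc u) σ is the state of the scan
  -- before position u is read: the first u positions are open, that is, their
  -- values are still to come.  In Good u u σ position u has been removed, but the
  -- value u has not been read.
  NoDrop : ℕ → ∀ {n} → Permutation′ n → Set
  NoDrop u σ = ∀ i j → u ≤ toℕ i → toℕ i < val σ i → val σ j ≡ suc (toℕ i) → toℕ i < toℕ j

  High : ℕ → ℕ → ∀ {n} → Permutation′ n → Set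
  High u l σ = ∀ i → toℕ i < u → l ≤ val σ i

  -- `High` keeps the values below `l` out of the open positions, and `NoDrop` is only required at
  -- indices not yet scanned. At the start, `Good 0 1`, `High` is vacuous and `NoDrop 0` is the
  -- condition shared by DE* and SDE.
  Good : ℕ → ℕ → ∀ {n} → Permutation′ n → Set
  Good u l σ = High u l σ × NoDrop u σ

  good? : ∀ u l {n} (σ : Permutation′ n) → Dec (Good u l σ)
  good? u l σ =
    (Fin.all? λ i → (toℕ i <? u) →-dec (l ≤? val σ i)) ×-dec
    (Fin.all? λ i → Fin.all? λ j → (u ≤? toℕ i) →-dec
      ((toℕ i <? val σ i) →-dec ((val σ j ≟ suc (toℕ i)) →-dec (toℕ i <? toℕ j))))

  module _ {n} (u : ℕ) (p : Fin n) (p≡u : toℕ p ≡ u) (σ : Permutation′ n) where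

    -- `NoDrop` at the excedance position u keeps the value u + 1 out of the positions up to u. The
    -- bound on the open positions therefore rises together with their number, without a choice: up
    -- steps carry no weight on this side.
    good-open : Good u (suc u) σ → u < val σ p → Good (suc u) (suc (suc u)) σ
    good-open (high , nodrop) u<σp = high′ , λ i j u<i → nodrop i j (<⇒≤ u<i)
      where
      above-u : ∀ i → toℕ i < suc u → u < val σ i
      above-u i (s≤s i≤u) with m≤n⇒m<n∨m≡n i≤u
      ... | inj₁ i<u = high i i<u
      ... | inj₂ i≡u with toℕ-injective (trans i≡u (sym p≡u))
      ...   | refl = u<σp
      high′ : High (suc u) (suc (suc u)) σ
      high′ i i<1+u with m≤n⇒m<n∨m≡n (above-u i i<1+u)
      ... | inj₁ lt = lt
      ... | inj₂ eq = contradiction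
        (nodrop p i (≤-reflexive (sym p≡u)) (subst (_< val σ p) (sym p≡u) u<σp) (trans (sym eq) (cong suc (sym p≡u))))
        (≤⇒≯ (≤-trans (≤-pred i<1+u) (≤-reflexive (sym p≡u))))

    good-open⁻ : Good (suc u) (suc (suc u)) σ → Good u (suc u) σ × u < val σ p
    good-open⁻ (high , nodrop) =
      ((λ i i<u → <⇒≤ (high i (m<n⇒m<1+n i<u))) , nodrop′) ,
      <⇒≤ (high p (s≤s (≤-reflexive p≡u)))
      where
      nodrop′ : NoDrop u σ
      nodrop′ i j u≤i i<σi eq with m≤n⇒m<n∨m≡n u≤i
      ... | inj₁ u<i  = nodrop i j u<i i<σi eq
      ... | inj₂ refl with u <? toℕ j
      ...   | yes lt = lt
      ...   | no u≮j = contradiction (high j (s≤s (≮⇒≥ u≮j))) (<-irrefl (sym eq))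

  module _ {n} (u : ℕ) (v : Fin n) (v≡u : toℕ v ≡ u) (σ : Permutation′ n) where

    good-skip : Good u u σ → u ≤ toℕ (σ ⟨$⟩ˡ v) → Good u (suc u) σ
    good-skip (high , nodrop) u≤σ⁻¹v = high′ , nodrop
      where
      high′ : High u (suc u) σ
      high′ i i<u with m≤n⇒m<n∨m≡n (high i i<u)
      ... | inj₁ lt = lt
      ... | inj₂ eq with toℕ-injective (trans v≡u eq)
      ...   | refl = contradiction (subst (λ j → toℕ j < u) (sym (inverseˡ σ)) i<u) (≤⇒≯ u≤σ⁻¹v)

    good-skip⁻ : Good u (suc u) σ → Good u u σ × u ≤ toℕ (σ ⟨$⟩ˡ v)
    good-skip⁻ (high , nodrop) = ((λ i i<u → <⇒≤ (high i i<u)) , nodrop) , ≮⇒≥ λ lt →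
      <-irrefl (sym (trans (cong toℕ (inverseʳ σ)) v≡u)) (high (σ ⟨$⟩ˡ v) lt)

  module _ {n} (p v : Fin (suc n)) (τ : Permutation′ n) where

    private
      σ : Permutation′ (suc n)
      σ = insert p v τ

    module _ {t u : ℕ} (p≤t : toℕ p ≤ t) (u≤1+t : u ≤ suc t) (v≤u : toℕ v ≤ u) where

      -- From index t on, all relevant positions and values lie beyond p and v and are shifted by
      -- one, so the condition for `τ` at i is the one for `σ` at i + 1. The lemma covers both
      -- removals: t = u when position u goes, u = t + 1 when a value goes.
      nodrop-remove : NoDrop u σ → NoDrop t τ
      nodrop-remove nodrop i j t≤i i<τi τj≡1+i = PunchIn-cancel (punchIn-view p i) (punchIn-view p j)
        (nodrop (punchIn p i) (punchIn p j)
          (subst (u ≤_) (sym i′) (≤-trans u≤1+t (s≤s t≤i)))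
          (subst₂ _<_ (sym i′) (sym (PunchIn-above (val-punchIn p v τ i) (≤-trans v≤1+i i<τi))) (s≤s i<τi))
          (trans (PunchIn-above (val-punchIn p v τ j) (≤-trans v≤1+i (≤-reflexive (sym τj≡1+i))))
            (trans (cong suc τj≡1+i) (cong suc (sym i′)))))
        where
        i′ : toℕ (punchIn p i) ≡ suc (toℕ i)
        i′ = PunchIn-above (punchIn-view p i) (≤-trans p≤t t≤i)
        v≤1+i : toℕ v ≤ suc (toℕ i)
        v≤1+i = ≤-trans v≤u (≤-trans u≤1+t (s≤s t≤i))

      -- Since v ≤ u ≤ x, the new pair is neither an excedance at x nor the carrier of the value x +
      -- 1; the rest is the shift by one. The two alternatives in `bound` are the two ways to see
      -- that the shifted index is still at least t.
      nodrop-insert : t ≤ u → t ≤ toℕ p ⊎ t < u → NoDrop t τ → NoDrop u σ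
      nodrop-insert t≤u bound nodrop x y u≤x x<σx σy≡1+x with insertView p x | insertView p y
      ... | at | _ = contradiction (≤-trans v≤u u≤x) (<⇒≱ (subst (toℕ p <_) (val-at p v τ) x<σx))
      ... | away i | at = contradiction (≤-trans v≤u u≤x)
        (<⇒≱ (≤-reflexive (trans (sym σy≡1+x) (val-at p v τ))))
      ... | away i | away j with toℕ (punchIn p i) | punchIn-view p i | val σ (punchIn p i) | val-punchIn p v τ i
      ...   | _ | below i<p | _ | _ = contradiction (<-≤-trans i<p (≤-trans p≤t (≤-trans t≤u u≤x))) (<-irrefl refl)
      ...   | _ | above p≤i | _ | τi =
        subst (suc (toℕ i) <_) (sym (PunchIn-above (punchIn-view p j) (≤-trans p≤i (<⇒≤ i<j)))) (s≤s i<j)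
        where
        t≤i : t ≤ toℕ i
        t≤i = [ (λ t≤p → ≤-trans t≤p p≤i) , (λ t<u → ≤-pred (≤-trans t<u u≤x)) ]′ bound
        i<τi : toℕ i < val τ i
        i<τi = PunchIn-pred τi x<σx
        τj≡1+i : val τ j ≡ suc (toℕ i)
        τj≡1+i with val σ (punchIn p j) | val-punchIn p v τ j
        ... | _ | below τj<v = contradiction (≤-trans v≤u u≤x) (<⇒≱ (<⇒≤ (subst (_< toℕ v) σy≡1+x τj<v)))
        ... | _ | above _    = suc-injective σy≡1+x
        i<j : toℕ i < toℕ j
        i<j = nodrop i j t≤i i<τi τj≡1+i

    module _ {u : ℕ} (p≡u : toℕ p ≡ u) (v≤u : toℕ v ≤ u) where

      -- The open positions lie left of p and keep their numbers. Their values exceed u, hence v,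
      -- and drop by one: the number of open positions stays and the bound falls to u.
      good-close-position : Good u (suc u) σ → Good u u τ
      good-close-position (high , nodrop) = high′ , nodrop-remove (≤-reflexive p≡u) (n≤1+n u) v≤u nodrop
        where
        high′ : High u u τ
        high′ i i<u with high (punchIn p i)
          (subst (_< u) (sym (PunchIn-below (punchIn-view p i) (subst (toℕ i <_) (sym p≡u) i<u))) i<u)
        ... | le with val σ (punchIn p i) | val-punchIn p v τ i
        ...   | _ | below _ = <⇒≤ le
        ...   | _ | above _ = ≤-pred le

      good-close-position⁻ : Good u u τ → Good u (suc u) σ
      good-close-position⁻ (high , nodrop) =
        high′ , nodrop-insert (≤-reflexive p≡u) (n≤1+n u) v≤u ≤-refl (inj₁ (≤-reflexive (sym p≡u))) nodrop
        where
        high′ : High u (suc u) σ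
        high′ x x<u with insertView p x
        ... | at = contradiction x<u (<-irrefl p≡u)
        ... | away i with toℕ (punchIn p i) | punchIn-view p i
        ...   | _ | below i<p = subst (u <_)
          (sym (PunchIn-above (val-punchIn p v τ i) (≤-trans v≤u (high i x<u)))) (s≤s (high i x<u))
        ...   | _ | above p≤i = contradiction (≤-trans (s≤s p≤i) (<⇒≤ x<u)) (<-irrefl p≡u)

    module _ {u : ℕ} (v≡1+u : toℕ v ≡ suc u) (p≤u : toℕ p ≤ u) where

      -- One open position disappears. The values at the others are at least u + 1 and differ from
      -- the removed value u + 1, so the bound u + 1 survives their drop by one.
      good-close-value : Good (suc u) (suc u) σ → Good u (suc u) τ
      good-close-value (high , nodrop) = high′ , nodrop-remove p≤u ≤-refl (≤-reflexive v≡1+u) nodrop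
        where
        high′ : High u (suc u) τ
        high′ i i<u with high (punchIn p i) (s≤s (punched i i<u))
          where
          punched : ∀ i → toℕ i < u → toℕ (punchIn p i) ≤ u
          punched i i<u with toℕ (punchIn p i) | punchIn-view p i
          ... | _ | below _ = <⇒≤ i<u
          ... | _ | above _ = i<u
        ... | le with val σ (punchIn p i) | val-punchIn p v τ i
        ...   | _ | below _ = le
        ...   | _ | above v≤τi = ≤-trans (≤-reflexive (sym v≡1+u)) v≤τi

      good-close-value⁻ : Good u (suc u) τ → Good (suc u) (suc u) σ
      good-close-value⁻ (high , nodrop) =
        high′ , nodrop-insert p≤u ≤-refl (≤-reflexive v≡1+u) (n≤1+n u) (inj₂ ≤-refl) nodrop
        where
        high′ : High (suc u) (suc u) σ
        high′ x x<1+u with insertView p x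
        ... | at = ≤-reflexive (sym (trans (val-at p v τ) v≡1+u))
        ... | away i = subst (suc u ≤_)
            (sym (PunchIn-above (val-punchIn p v τ i) (≤-trans (≤-reflexive v≡1+u) (high i i<u))))
            (m≤n⇒m≤1+n (high i i<u))
          where
          i<u : toℕ i < u
          i<u with toℕ (punchIn p i) | punchIn-view p i
          ... | _ | below i<p = <-≤-trans i<p p≤u
          ... | _ | above _   = ≤-pred x<1+u

  -- The conditions on `scda`, `cda*` and `fix*` as the initial state `Good 0 1`.

  module _ {a p} {A : Set a} {P : Pred A p} (P? : Decidable P) where

    count≡0⁺ : ∀ {xs} → (∀ {x} → x ∈ xs → ¬ P x) → count P? xs ≡ 0
    count≡0⁺ none rewrite filter-none P? (All.tabulate none) = refl

    count≡0⁻ : ∀ {xs} → count P? xs ≡ 0 → ∀ {x} → x ∈ xs → ¬ P x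
    count≡0⁻ eq x∈xs px = <-irrefl (sym eq) (filter-some P? (lose x∈xs px))

  module _ {n} (σ : Permutation′ n) where

    private
      Scda : Pred ℕ _
      Scda i = i < word σ i × word {n} (flip σ) (i + 1) < i + 1

      scda? : Decidable Scda
      scda? i = (i <? word σ i) ×-dec (word {n} (flip σ) (i + 1) <? i + 1)

      Cda* : Pred (Fin (suc n)) _
      Cda* i = (1 ≤ toℕ i × toℕ i < n) × toℕ (star σ ⟨$⟩ˡ i) < toℕ i × toℕ i < toℕ (star σ ⟨$⟩ʳ i)

      cda*? : Decidable Cda*
      cda*? i = ((1 ≤? toℕ i) ×-dec (toℕ i <? n))
        ×-dec (toℕ (star σ ⟨$⟩ˡ i) <? toℕ i) ×-dec (toℕ i <? toℕ (star σ ⟨$⟩ʳ i))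

      Fix* : Pred (Fin (suc n)) _
      Fix* i = (1 ≤ toℕ i × toℕ i < n) × toℕ (star σ ⟨$⟩ʳ i) ≡ toℕ i

      fix*? : Decidable Fix*
      fix*? i = ((1 ≤? toℕ i) ×-dec (toℕ i <? n)) ×-dec (toℕ (star σ ⟨$⟩ʳ i) ≟ toℕ i)

      word⁻¹-suc : ∀ {i : Fin n} (j : Fin n) → val σ j ≡ suc (toℕ i) → word {n} (flip σ) (suc (toℕ i) + 1) ≡ suc (toℕ j)
      word⁻¹-suc {i} j eq = begin
        word {n} (flip σ) (suc (toℕ i) + 1)        ≡⟨ cong (word {n} (flip σ)) (+-comm (suc (toℕ i)) 1) ⟩
        word {n} (flip σ) (suc (suc (toℕ i)))      ≡⟨ cong (word {n} (flip σ) ∘ suc) eq ⟨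
        word {n} (flip σ) (suc (val σ j))          ≡⟨ word-suc (flip σ) (σ ⟨$⟩ʳ j) ⟩
        suc (toℕ (σ ⟨$⟩ˡ (σ ⟨$⟩ʳ j)))          ≡⟨ cong (suc ∘ toℕ) (inverseˡ σ) ⟩
        suc (toℕ j)                            ∎
        where open ≡-Reasoning

    scda≡0⇒good : scda σ ≡ 0 → Good 0 1 σ
    scda≡0⇒good eq = (λ _ ()) , λ i j _ i<σi σj≡1+i → ≰⇒> λ j≤i →
      count≡0⁻ scda? eq
        (∈-map⁺ suc (∈-upTo⁺ (∸-monoˡ-≤ 1 (subst (_< n) σj≡1+i (toℕ<n (σ ⟨$⟩ʳ j))))))
        ( subst (suc (toℕ i) <_) (sym (word-suc σ i)) (s≤s i<σi)
        , subst₂ _<_ (sym (word⁻¹-suc {i} j σj≡1+i)) (+-comm 1 (suc (toℕ i))) (s≤s (s≤s j≤i)))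

    good⇒scda≡0 : Good 0 1 σ → scda σ ≡ 0
    good⇒scda≡0 (_ , nodrop) = count≡0⁺ scda? none
      where
      none : ∀ {x} → x ∈ [1⋯ n ∸ 1 ] → ¬ Scda x
      none x∈ (x<σx , σ⁻¹<) with ∈-map⁻ suc x∈
      ... | k , k∈ , refl = <⇒≱
        (nodrop i j z≤n
          (≤-pred (subst₂ (λ a b → suc a < b) (sym i≡k) (trans (cong (word σ ∘ suc) (sym i≡k)) (word-suc σ i)) x<σx)) σj)
        (≤-pred (≤-pred (subst₂ _<_ (trans (cong (λ a → word {n} (flip σ) (suc a + 1)) (sym i≡k)) (word⁻¹-suc {i} j σj))
          (trans (+-comm (suc k) 1) (cong (2 +_) (sym i≡k))) σ⁻¹<)))
        where
        <∸⇒+< : ∀ m → k < m ∸ 1 → suc k + 1 ≤ m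
        <∸⇒+< (suc m) lt = subst (_≤ suc m) (+-comm 1 (suc k)) (s≤s lt)
        1+k<n : suc k < n
        1+k<n = subst (_≤ n) (+-comm (suc k) 1) (<∸⇒+< n (∈-upTo⁻ k∈))
        i : Fin n
        i = fromℕ< (<⇒≤ 1+k<n)
        i≡k : toℕ i ≡ k
        i≡k = toℕ-fromℕ< _
        j : Fin n
        j = σ ⟨$⟩ˡ fromℕ< 1+k<n
        σj : val σ j ≡ suc (toℕ i)
        σj = trans (cong toℕ (inverseʳ σ)) (trans (toℕ-fromℕ< _) (cong suc (sym i≡k)))

    private
      star-val : ∀ i → toℕ (star σ ⟨$⟩ʳ suc i) ≡ val σ i
      star-val i = trans (cong toℕ (star-suc σ i)) (toℕ-inject₁ _)

    -- In 0-based terms `star σ` sends i + 1 to σ(i). A violation j ≤ i of `NoDrop` is a fixed point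
    -- i + 1 of `star σ` if j = i. If j < i, the value i + 1 is taken by j, so σ(i) > i + 1, and i +
    -- 1 is counted by `cda*`.
    star≡0⇒good : cda* σ + fix* σ ≡ 0 → Good 0 1 σ
    star≡0⇒good eq = (λ _ ()) , λ i j _ i<σi σj≡1+i → ≰⇒> (no-drop i j i<σi σj≡1+i)
      where
      no-drop : ∀ i j → toℕ i < val σ i → val σ j ≡ suc (toℕ i) → ¬ toℕ j ≤ toℕ i
      no-drop i j i<σi σj≡1+i j≤i with m≤n⇒m<n∨m≡n j≤i
      ... | inj₂ j≡i = count≡0⁻ fix*? (m+n≡0⇒n≡0 (cda* σ) eq) (∈-allFin (suc i))
        ((s≤s z≤n , 1+i<n) , trans (star-val i) (subst (λ k → val σ k ≡ suc (toℕ i)) (toℕ-injective j≡i) σj≡1+i))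
        where
        1+i<n : suc (toℕ i) < n
        1+i<n = subst (_< n) σj≡1+i (toℕ<n (σ ⟨$⟩ʳ j))
      ... | inj₁ j<i = count≡0⁻ cda*? (m+n≡0⇒m≡0 (cda* σ) eq) (∈-allFin (suc i))
        ((s≤s z≤n , 1+i<n) , subst (_< suc (toℕ i)) (sym star⁻¹) (s≤s j<i)
        , subst (suc (toℕ i) <_) (sym (star-val i)) 1+i<σi)
        where
        1+i<n : suc (toℕ i) < n
        1+i<n = subst (_< n) σj≡1+i (toℕ<n (σ ⟨$⟩ʳ j))
        star⁻¹ : toℕ (star σ ⟨$⟩ˡ suc i) ≡ suc (toℕ j)
        star⁻¹ = cong toℕ (trans (cong (star σ ⟨$⟩ˡ_) (toℕ-injective (sym (trans (star-val j) σj≡1+i)))) (inverseˡ (star σ)))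
        1+i<σi : suc (toℕ i) < val σ i
        1+i<σi with m≤n⇒m<n∨m≡n i<σi
        ... | inj₁ lt = lt
        ... | inj₂ e with toℕ-injective (trans σj≡1+i e)
        ...   | e′ = contradiction (cong toℕ (trans (sym (inverseˡ σ)) (trans (cong (σ ⟨$⟩ˡ_) e′) (inverseˡ σ)))) (<⇒≢ j<i)

    good⇒star≡0 : Good 0 1 σ → cda* σ + fix* σ ≡ 0
    good⇒star≡0 (_ , nodrop) = cong₂ _+_ (count≡0⁺ cda*? {allFin (suc n)} (λ {x} _ → no-cda x))
      (count≡0⁺ fix*? {allFin (suc n)} (λ {x} _ → no-fix x))
      where
      no-cda : ∀ x → ¬ Cda* x
      no-cda (suc i) ((_ , 1+i<n) , <x , x<) with star σ ⟨$⟩ˡ suc i in eq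
      -- `star σ` sends 0 to n, so a preimage 0 would force i + 1 = n.
      ... | zero  = <-irrefl
        (trans (cong toℕ (trans (sym (inverseʳ (star σ))) (cong (star σ ⟨$⟩ʳ_) eq))) (toℕ-fromℕ n)) 1+i<n
      ... | suc j = <-asym (nodrop i j z≤n (<⇒≤ (subst (suc (toℕ i) <_) (star-val i) x<))
        (trans (sym (star-val j)) (cong toℕ (trans (cong (star σ ⟨$⟩ʳ_) (sym eq)) (inverseʳ (star σ)))))) (≤-pred <x)
      no-fix : ∀ x → ¬ Fix* x
      no-fix (suc i) (_ , eq) = <-irrefl refl (nodrop i i z≤n (≤-reflexive (sym σi)) σi)
        where
        σi : val σ i ≡ suc (toℕ i)
        σi = trans (sym (star-val i)) eq

  -- Both filters select by `Good 0 1` from the same list, so even the lists agree.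
  DE*≡SDE : ∀ n k → DE* n k ≡ SDE n k
  DE*≡SDE n k = filter-≐ _ _
    ( (λ {σ} (e , s) → e , good⇒scda≡0 σ (star≡0⇒good σ s))
    , (λ {σ} (e , s) → e , good⇒star≡0 σ (scda≡0⇒good σ s))) (perms n)

-- Words with bars and their statistics.

module Cuts where

  open Permutations
  open import Data.Fin.Base using (toℕ; fromℕ<)
  open import Data.Fin.Permutation using (Permutation′)
  open import Data.Fin.Properties using (toℕ<n; toℕ-fromℕ<)
  open import Data.List.Base using (List; []; _∷_; map)
  open import Data.List.Relation.Binary.Pointwise as Pointwise using (Pointwise; []; _∷_)
  open import Data.List.Relation.Unary.All as All using (All; []; _∷_)
  import Data.List.Relation.Unary.All.Properties as All
  open import Data.Nat.Base using (zero; suc; _+_; _∸_; _≤_; z≤n; s≤s)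
  open import Data.Nat.Properties
  open import Data.Nat.Tactic.RingSolver using (solve-∀)
  open import Data.Product.Base using (_,_; proj₁; proj₂)
  open import Function.Base using (_∘_)
  open import Relation.Binary.PropositionalEquality
  open import Relation.Nullary.Decidable.Core using (_×-dec_)
  open import Algebra.Properties.CommutativeMonoid.Sum +-0-commutativeMonoid using (sum; sum-cong-≗; ∑-comm)

  infixr 5 _▹_ _∣_

  -- A word with bars between some of its letters.  A bar is a place still to be
  -- filled by smaller letters: all statistics treat it as a letter 0 and all
  -- letters as positive.
  data Cut : Set where
    letter : ℕ → Cut
    _▹_    : ℕ → Cut → Cut
    _∣_    : ℕ → Cut → Cut

  first : Cut → ℕ
  first (letter a) = a
  first (a ▹ c)    = a
  first (a ∣ c)    = a

  bars : Cut → ℕ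
  bars (letter a) = 0
  bars (a ▹ c)    = bars c
  bars (a ∣ c)    = suc (bars c)

  desᶜ : Cut → ℕ
  desᶜ (letter a) = 0
  desᶜ (a ▹ c)    = 𝟙 (first c <? a) + desᶜ c
  desᶜ (a ∣ c)    = suc (desᶜ c)

  -- The first argument is the letter preceding the cut word.
  ddᶜ : ℕ → Cut → ℕ
  ddᶜ p (letter a) = 𝟙 (a <? p)
  ddᶜ p (a ▹ c)    = 𝟙 ((a <? p) ×-dec (first c <? a)) + ddᶜ a c
  ddᶜ p (a ∣ c)    = 𝟙 (a <? p) + ddᶜ 0 c

  -- Candidates for the 2 of a 31-2 whose 3 is `h` and whose 1 is `l`. Bars are passed over, since 0
  -- never exceeds `l`.
  between : ℕ → ℕ → Cut → ℕ
  between l h (letter b) = 𝟙 ((l <? b) ×-dec (b <? h))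
  between l h (b ▹ c)    = 𝟙 ((l <? b) ×-dec (b <? h)) + between l h c
  between l h (b ∣ c)    = 𝟙 ((l <? b) ×-dec (b <? h)) + between l h c

  -- Candidates for the 13 of a 2-13 whose 2 is `a`; `p` is the entry just before the cut word. A
  -- bar can be the 1 but never the 3.
  ascents : ℕ → ℕ → Cut → ℕ
  ascents a p (letter b) = 𝟙 ((p <? a) ×-dec (a <? b))
  ascents a p (b ▹ c)    = 𝟙 ((p <? a) ×-dec (a <? b)) + ascents a b c
  ascents a p (b ∣ c)    = 𝟙 ((p <? a) ×-dec (a <? b)) + ascents a 0 c

  -- The count over `c` includes its first letter, which in the case `a ▹ c` is the 1 itself and is
  -- ruled out by the strict inequality. In the case `a ∣ c` the 1 is the bar, and that letter may
  -- well be the 2.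
  31-2ᶜ : Cut → ℕ
  31-2ᶜ (letter a) = 0
  31-2ᶜ (a ▹ c)    = between (first c) a c + 31-2ᶜ c
  31-2ᶜ (a ∣ c)    = between 0 a c + 31-2ᶜ c

  2-13ᶜ : Cut → ℕ
  2-13ᶜ (letter a) = 0
  2-13ᶜ (a ▹ c)    = ascents a a c + 2-13ᶜ c
  2-13ᶜ (a ∣ c)    = ascents a 0 c + 2-13ᶜ c

  stat : Cut → ℕ
  stat c = 2 * 31-2ᶜ c + 2-13ᶜ c

  Above : ℕ → Cut → Set
  Above y (letter a) = y < a
  Above y (a ▹ c)    = y < a × Above y c
  Above y (a ∣ c)    = y < a × Above y c

  above-first : ∀ {y} c → Above y c → y < first c
  above-first (letter a) y<a       = y<a
  above-first (a ▹ c)    (y<a , _) = y<a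
  above-first (a ∣ c)    (y<a , _) = y<a

  -- The effect of inserting a letter below all others.

  module _ {y : ℕ} (0<y : 0 < y) where

    between-none : ∀ l c → Above y c → between l y c ≡ 0
    between-none l (letter b) y<b = 𝟙-no ((l <? b) ×-dec (b <? y)) λ (_ , b<y) → <-asym y<b b<y
    between-none l (b ▹ c) (y<b , ab) = cong₂ _+_ (between-none l (letter b) y<b) (between-none l c ab)
    between-none l (b ∣ c) (y<b , ab) = cong₂ _+_ (between-none l (letter b) y<b) (between-none l c ab)

    between-start : ∀ h c → Above y c → between y h c ≡ between 0 h c
    between-start h (letter b) y<b = 𝟙-cong ((y <? b) ×-dec (b <? h)) ((0 <? b) ×-dec (b <? h))
      (λ (y<b , b<h) → ≤-<-trans z≤n y<b , b<h) (λ (_ , b<h) → y<b , b<h)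
    between-start h (b ▹ c) (y<b , ab) = cong₂ _+_ (between-start h (letter b) y<b) (between-start h c ab)
    between-start h (b ∣ c) (y<b , ab) = cong₂ _+_ (between-start h (letter b) y<b) (between-start h c ab)

    ascents-start : ∀ {a} p r c → p < a → r < a → ascents a p c ≡ ascents a r c
    ascents-start {a} p r (letter b) p<a r<a = 𝟙-cong ((p <? a) ×-dec (a <? b)) ((r <? a) ×-dec (a <? b))
      (λ (_ , a<b) → r<a , a<b) (λ (_ , a<b) → p<a , a<b)
    ascents-start p r (b ▹ c) p<a r<a = cong (_+ _) (ascents-start p r (letter b) p<a r<a)
    ascents-start p r (b ∣ c) p<a r<a = cong (_+ _) (ascents-start p r (letter b) p<a r<a)

    mutual
      -- All letters exceed y, so an ascent passes over y only if it starts at a bar. Each bar to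
      -- the right of y thus makes y the 2 of exactly one 2-13; the companion lemma counts one more
      -- bar, standing in front of `c`.
      ascents-own : ∀ {p} c → y ≤ p → Above y c → ascents y p c ≡ bars c
      ascents-own {p} (letter b) y≤p _ = 𝟙-no ((p <? y) ×-dec (y <? b)) λ (p<y , _) → ≤⇒≯ y≤p p<y
      ascents-own (b ▹ c) y≤p (y<b , ab) = cong₂ _+_ (ascents-own (letter b) y≤p y<b) (ascents-own c (<⇒≤ y<b) ab)
      ascents-own (b ∣ c) y≤p (y<b , ab) = cong₂ _+_ (ascents-own (letter b) y≤p y<b) (ascents-own-0 c ab)

      ascents-own-0 : ∀ c → Above y c → ascents y 0 c ≡ suc (bars c)
      ascents-own-0 (letter b) y<b = 𝟙-yes ((0 <? y) ×-dec (y <? b)) (0<y , y<b)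
      ascents-own-0 (b ▹ c) (y<b , ab) = cong₂ _+_ (ascents-own-0 (letter b) y<b) (ascents-own c (<⇒≤ y<b) ab)
      ascents-own-0 (b ∣ c) (y<b , ab) = cong₂ _+_ (ascents-own-0 (letter b) y<b) (ascents-own-0 c ab)

    dd-start : ∀ {p} c → p ≤ y → Above y c → ddᶜ p c ≡ ddᶜ 0 c
    dd-start {p} (letter a) p≤y y<a = trans (𝟙-no (a <? p) (<⇒≯ (≤-<-trans p≤y y<a))) (sym (𝟙-no (a <? 0) λ ()))
    dd-start {p} (a ▹ c) p≤y (y<a , _) = cong (_+ _) (trans
      (𝟙-no ((a <? p) ×-dec (first c <? a)) λ (a<p , _) → <⇒≯ (≤-<-trans p≤y y<a) a<p)
      (sym (𝟙-no ((a <? 0) ×-dec (first c <? a)) λ ())))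
    dd-start (a ∣ c) p≤y (y<a , _) = cong (_+ _) (dd-start (letter a) p≤y y<a)

    -- c′ arises from c by inserting the letter y below all letters of c.  Extends₀
    -- only keeps what matters behind a bar (or at the start of the word); Extends
    -- also allows further letters in front.
    record Extends₀ (e δ : ℕ) (c c′ : Cut) (i : ℕ) : Set where
      field
        bars-eq    : e + bars c′ ≡ δ + bars c
        des-eq     : desᶜ c′ ≡ δ + desᶜ c
        dd-eq      : ddᶜ 0 c′ ≡ ddᶜ 0 c
        between-eq : ∀ {l h} → y < l → between l h c′ ≡ between l h c
        low-eq     : ∀ {h} → y < h → between 0 h c′ ≡ suc (between 0 h c)
        ascents-eq : ∀ {a} → y < a → ascents a 0 c′ ≡ ascents a 0 c
        stat-eq    : stat c′ ≡ i + stat c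

    record Extends (e δ : ℕ) (c c′ : Cut) (i : ℕ) : Set where
      field
        extends₀    : Extends₀ e δ c c′ i
        first-eq    : first c′ ≡ first c
        dd-eqᵖ      : ∀ p → ddᶜ p c′ ≡ ddᶜ p c
        ascents-eqᵖ : ∀ {a} p → y < a → ascents a p c′ ≡ ascents a p c
      open Extends₀ extends₀ public

    module _ {e δ a : ℕ} {c c′ : Cut} {i : ℕ} where

      -- The first letter of `c` stays in place, so the junction with `a` is unchanged. As y lies
      -- below both of its letters, y takes part in no new pattern there, and the increment stays
      -- `i`.
      extends-▹ : y < a → Above y c → Extends e δ c c′ i → Extends e δ (a ▹ c) (a ▹ c′) i
      extends-▹ y<a ab E = record
        { extends₀ = record
          { bars-eq    = bars-eq
          ; des-eq     = trans (cong₂ (λ f d → 𝟙 (f <? a) + d) first-eq des-eq) (swap (𝟙 (first c <? a)) δ (desᶜ c))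
          ; dd-eq      = dd▹ 0
          ; between-eq = λ y<l → cong (_ +_) (between-eq y<l)
          ; low-eq     = λ y<h → trans (cong (_ +_) (low-eq y<h)) (+-suc _ _)
          ; ascents-eq = λ y<a → cong (_ +_) (ascents-eqᵖ a y<a)
          ; stat-eq    = trans (cong₂ (λ m n → 2 * (m + 31-2ᶜ c′) + (n + 2-13ᶜ c′))
              (trans (cong (λ f → between f a c′) first-eq) (between-eq (above-first c ab))) (ascents-eqᵖ a y<a))
              (stat-context (between (first c) a c) (ascents a a c) (31-2ᶜ c) (2-13ᶜ c) (31-2ᶜ c′) (2-13ᶜ c′) stat-eq)
          }
        ; first-eq    = refl
        ; dd-eqᵖ      = dd▹
        ; ascents-eqᵖ = λ _ y<a → cong (_ +_) (ascents-eqᵖ a y<a)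
        }
        where
        open Extends E
        dd▹ : ∀ p → ddᶜ p (a ▹ c′) ≡ ddᶜ p (a ▹ c)
        dd▹ p = cong₂ (λ f d → 𝟙 ((a <? p) ×-dec (f <? a)) + d) first-eq (dd-eqᵖ a)
        swap : ∀ m n o → m + (n + o) ≡ n + (m + o)
        swap = solve-∀
        stat-context : ∀ m n s t s′ t′ → 2 * s′ + t′ ≡ i + (2 * s + t) →
          2 * (m + s′) + (n + t′) ≡ i + (2 * (m + s) + (n + t))
        stat-context m n s t s′ t′ eq = trans (expand m n s′ t′) (trans (cong (2 * m + n +_) eq) (collect m n i s t))
          where
          expand : ∀ m n s t → 2 * (m + s) + (n + t) ≡ 2 * m + n + (2 * s + t)
          expand = solve-∀
          collect : ∀ m n i s t → 2 * m + n + (i + (2 * s + t)) ≡ i + (2 * (m + s) + (n + t))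
          collect = solve-∀

      -- The descent from `a` to the bar has y as an additional 2, because 0 < y < a. This one 31-2
      -- counts twice in `stat`, hence `2 + i`.
      extends-∣ : y < a → Extends₀ e δ c c′ i → Extends e δ (a ∣ c) (a ∣ c′) (2 + i)
      extends-∣ y<a E = record
        { extends₀ = record
          { bars-eq    = trans (+-suc e _) (trans (cong suc bars-eq) (sym (+-suc δ _)))
          ; des-eq     = trans (cong suc des-eq) (sym (+-suc δ _))
          ; dd-eq      = cong (_ +_) dd-eq
          ; between-eq = λ y<l → cong (_ +_) (between-eq y<l)
          ; low-eq     = λ y<h → trans (cong (_ +_) (low-eq y<h)) (+-suc _ _)
          ; ascents-eq = λ y<a → cong (_ +_) (ascents-eq y<a)
          ; stat-eq    = trans (cong₂ (λ m n → 2 * (m + 31-2ᶜ c′) + (n + 2-13ᶜ c′)) (low-eq y<a) (ascents-eq y<a))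
              (stat-context (between 0 a c) (ascents a 0 c) (31-2ᶜ c) (2-13ᶜ c) (31-2ᶜ c′) (2-13ᶜ c′) stat-eq)
          }
        ; first-eq    = refl
        ; dd-eqᵖ      = λ p → cong (_ +_) dd-eq
        ; ascents-eqᵖ = λ p y<a → cong (_ +_) (ascents-eq y<a)
        }
        where
        open Extends₀ E
        stat-context : ∀ m n s t s′ t′ → 2 * s′ + t′ ≡ i + (2 * s + t) →
          2 * (suc m + s′) + (n + t′) ≡ 2 + i + (2 * (m + s) + (n + t))
        stat-context m n s t s′ t′ eq = trans (expand m n s′ t′) (trans (cong (2 + 2 * m + n +_) eq) (collect m n i s t))
          where
          expand : ∀ m n s t → 2 * (suc m + s) + (n + t) ≡ 2 + 2 * m + n + (2 * s + t)
          expand = solve-∀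
          collect : ∀ m n i s t → 2 + 2 * m + n + (i + (2 * s + t)) ≡ 2 + i + (2 * (m + s) + (n + t))
          collect = solve-∀

    low-𝟙 : ∀ {h} → y < h → 𝟙 ((0 <? y) ×-dec (y <? h)) ≡ 1
    low-𝟙 {h} y<h = 𝟙-yes ((0 <? y) ×-dec (y <? h)) (0<y , y<h)

    high-𝟙 : ∀ {l h} → y < l → 𝟙 ((l <? y) ×-dec (y <? h)) ≡ 0
    high-𝟙 {l} {h} y<l = 𝟙-no ((l <? y) ×-dec (y <? h)) λ (l<y , _) → <-asym y<l l<y

    ascent-𝟙 : ∀ {a} → y < a → 𝟙 ((0 <? a) ×-dec (a <? y)) ≡ 0
    ascent-𝟙 {a} y<a = 𝟙-no ((0 <? a) ×-dec (a <? y)) λ (_ , a<y) → <-asym y<a a<y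

    module _ {c} (ab : Above y c) where

      front-▹ : Extends₀ 0 0 c (y ▹ c) (bars c)
      front-▹ = record
        { bars-eq    = refl
        ; des-eq     = cong (_+ _) (𝟙-no (first c <? y) (<-asym (above-first c ab)))
        ; dd-eq      = trans (cong (_+ ddᶜ y c) (𝟙-no ((y <? 0) ×-dec (first c <? y)) λ ())) (dd-start c ≤-refl ab)
        ; between-eq = λ y<l → cong (_+ _) (high-𝟙 y<l)
        ; low-eq     = λ y<h → cong (_+ _) (low-𝟙 y<h)
        ; ascents-eq = λ {a} y<a → trans (cong (_+ ascents a y c) (ascent-𝟙 y<a)) (ascents-start y 0 c y<a (<-trans 0<y y<a))
        ; stat-eq    = trans (cong₂ (λ m n → 2 * (m + 31-2ᶜ c) + (n + 2-13ᶜ c))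
            (between-none (first c) c ab) (ascents-own c ≤-refl ab)) (swap (31-2ᶜ c) (bars c) (2-13ᶜ c))
        }
        where
        swap : ∀ s n t → 2 * s + (n + t) ≡ n + (2 * s + t)
        swap = solve-∀

      -- The bar placed right after y is followed by a larger letter and so begins an ascent over y
      -- as well: one 2-13 more than in `front-▹`.
      front-∣ : Extends₀ 0 1 c (y ∣ c) (suc (bars c))
      front-∣ = record
        { bars-eq    = refl
        ; des-eq     = refl
        ; dd-eq      = cong (_+ ddᶜ 0 c) (𝟙-no (y <? 0) λ ())
        ; between-eq = λ y<l → cong (_+ _) (high-𝟙 y<l)
        ; low-eq     = λ y<h → cong (_+ _) (low-𝟙 y<h)
        ; ascents-eq = λ y<a → cong (_+ _) (ascent-𝟙 y<a)
        ; stat-eq    = trans (cong₂ (λ m n → 2 * (m + 31-2ᶜ c) + (n + 2-13ᶜ c))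
            (between-none 0 c ab) (ascents-own-0 c ab)) (swap (31-2ᶜ c) (suc (bars c)) (2-13ᶜ c))
        }
        where
        swap : ∀ s n t → 2 * s + (n + t) ≡ n + (2 * s + t)
        swap = solve-∀

      valley : ∀ {a} → y < a → Extends 1 0 (a ∣ c) (a ▹ y ▹ c) (bars c)
      valley {a} y<a = record
        { extends₀ = record
          { bars-eq    = refl
          ; des-eq     = cong₂ _+_ (𝟙-yes (y <? a) y<a) des-eq
          ; dd-eq      = dd▹ 0
          ; between-eq = λ y<l → cong (_ +_) (between-eq y<l)
          ; low-eq     = λ {h} y<h → trans (cong (between 0 h (letter a) +_) (low-eq y<h))
            (+-suc (between 0 h (letter a)) (between 0 h c))
          ; ascents-eq = λ {x} y<x → ascents▹ 0 y<x
          ; stat-eq    = trans (cong₂ (λ m n → 2 * (m + 31-2ᶜ (y ▹ c)) + (n + 2-13ᶜ (y ▹ c)))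
              (trans (cong (_+ between y a c) (𝟙-no ((y <? y) ×-dec (y <? a)) λ (lt , _) → <-irrefl refl lt))
                (between-start a c ab))
              (trans (cong (_+ ascents a y c) (𝟙-no ((a <? a) ×-dec (a <? y)) λ (lt , _) → <-irrefl refl lt))
                (ascents-start y 0 c y<a (<-trans 0<y y<a))))
              (stat-context (between 0 a c) (ascents a 0 c) (31-2ᶜ c) (2-13ᶜ c) (31-2ᶜ (y ▹ c)) (2-13ᶜ (y ▹ c)) stat-eq)
          }
        ; first-eq    = refl
        ; dd-eqᵖ      = dd▹
        ; ascents-eqᵖ = λ p y<x → ascents▹ p y<x
        }
        where
        open Extends₀ front-▹
        dd▹ : ∀ p → ddᶜ p (a ▹ y ▹ c) ≡ ddᶜ p (a ∣ c)
        dd▹ p = cong₂ _+_ (𝟙-cong ((a <? p) ×-dec (y <? a)) (a <? p) proj₁ (_, y<a))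
          (trans (cong (_+ ddᶜ y c) (𝟙-no ((y <? a) ×-dec (first c <? y)) λ (_ , lt) → <-asym (above-first c ab) lt))
            (dd-start c ≤-refl ab))
        ascents▹ : ∀ {x} p → y < x → ascents x p (a ▹ y ▹ c) ≡ ascents x p (a ∣ c)
        ascents▹ {x} p y<x = cong (_ +_) (trans
          (cong (_+ ascents x y c) (𝟙-no ((a <? x) ×-dec (x <? y)) λ (_ , lt) → <-asym y<x lt))
          (ascents-start y 0 c y<x (<-trans 0<y y<x)))
        stat-context : ∀ m n s t s′ t′ → 2 * s′ + t′ ≡ bars c + (2 * s + t) →
          2 * (m + s′) + (n + t′) ≡ bars c + (2 * (m + s) + (n + t))
        stat-context m n s t s′ t′ eq = trans (expand m n s′ t′) (trans (cong (2 * m + n +_) eq) (collect m n (bars c) s t))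
          where
          expand : ∀ m n s t → 2 * (m + s) + (n + t) ≡ 2 * m + n + (2 * s + t)
          expand = solve-∀
          collect : ∀ m n i s t → 2 * m + n + (i + (2 * s + t)) ≡ i + (2 * (m + s) + (n + t))
          collect = solve-∀

    -- The increment 2 comes from the single 31-2 formed by `a`, the new bar and y; no bar stands to
    -- the right of y.
    final-peak : ∀ {a} → y < a → Extends 0 1 (letter a) (a ∣ letter y) 2
    final-peak {a} y<a = record
      { extends₀ = record
        { bars-eq    = refl
        ; des-eq     = refl
        ; dd-eq      = dd▹ 0
        ; between-eq = λ y<l → trans (cong (_ +_) (high-𝟙 y<l)) (+-identityʳ _)
        ; low-eq     = λ y<h → trans (cong (_ +_) (low-𝟙 y<h)) (+-comm _ 1)
        ; ascents-eq = λ y<x → trans (cong (_ +_) (ascent-𝟙 y<x)) (+-identityʳ _)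
        ; stat-eq    = cong₂ (λ m n → 2 * (m + 0) + (n + 0)) (low-𝟙 y<a) (ascent-𝟙 y<a)
        }
      ; first-eq    = refl
      ; dd-eqᵖ      = dd▹
      ; ascents-eqᵖ = λ p y<x → trans (cong (_ +_) (ascent-𝟙 y<x)) (+-identityʳ _)
      }
      where
      dd▹ : ∀ p → ddᶜ p (a ∣ letter y) ≡ ddᶜ p (letter a)
      dd▹ p = trans (cong (𝟙 (a <? p) +_) (𝟙-no (y <? 0) λ ())) (+-identityʳ _)

  -- All results of inserting y into c: y replaces a bar, or stands after a bar,
  -- between two copies of a bar, or before a bar.  The inner versions leave the
  -- first letter of c in place.
  valleys innerAscents innerPeaks descents : ℕ → Cut → List Cut

  valleys y (letter a) = []
  valleys y (a ▹ c)    = map (a ▹_) (valleys y c)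
  valleys y (a ∣ c)    = (a ▹ y ▹ c) ∷ map (a ∣_) (valleys y c)

  innerAscents y (letter a) = []
  innerAscents y (a ▹ c)    = map (a ▹_) (innerAscents y c)
  innerAscents y (a ∣ c)    = (a ∣ y ▹ c) ∷ map (a ∣_) (innerAscents y c)

  innerPeaks y (letter a) = (a ∣ letter y) ∷ []
  innerPeaks y (a ▹ c)    = map (a ▹_) (innerPeaks y c)
  innerPeaks y (a ∣ c)    = (a ∣ y ∣ c) ∷ map (a ∣_) (innerPeaks y c)

  descents y (letter a) = (a ▹ letter y) ∷ []
  descents y (a ▹ c)    = map (a ▹_) (descents y c)
  descents y (a ∣ c)    = (a ▹ y ∣ c) ∷ map (a ∣_) (descents y c)

  ascendings peaks : ℕ → Cut → List Cut
  ascendings y c = (y ▹ c) ∷ innerAscents y c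
  peaks y c      = (y ∣ c) ∷ innerPeaks y c

  -- The insertion places from left to right. At the leftmost one all bars lie to the right and each
  -- counts 1; every bar that is passed changes its contribution from 1 to 2. So
  -- `increments (suc z)` lists z, z + 1, ..., 2z.
  increments : ℕ → List ℕ
  increments zero    = []
  increments (suc z) = z ∷ map (2 +_) (increments z)

  module _ {y : ℕ} (0<y : 0 < y) where

    open Extends using (extends₀)

    private
      lift-▹ : ∀ {e δ a c cs is} → y < a → Above y c → Pointwise (Extends 0<y e δ c) cs is →
        Pointwise (Extends 0<y e δ (a ▹ c)) (map (a ▹_) cs) is
      lift-▹ y<a ab []       = []
      lift-▹ y<a ab (E ∷ Es) = extends-▹ 0<y y<a ab E ∷ lift-▹ y<a ab Es

      lift-∣ : ∀ {e δ a c cs is} → y < a → Pointwise (Extends 0<y e δ c) cs is →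
        Pointwise (Extends 0<y e δ (a ∣ c)) (map (a ∣_) cs) (map (2 +_) is)
      lift-∣ y<a []       = []
      lift-∣ y<a (E ∷ Es) = extends-∣ 0<y y<a (extends₀ E) ∷ lift-∣ y<a Es

    valleys-extend : ∀ c → Above y c → Pointwise (Extends 0<y 1 0 c) (valleys y c) (increments (bars c))
    valleys-extend (letter a) _        = []
    valleys-extend (a ▹ c) (y<a , ab) = lift-▹ y<a ab (valleys-extend c ab)
    valleys-extend (a ∣ c) (y<a , ab) = valley 0<y ab y<a ∷ lift-∣ y<a (valleys-extend c ab)

    innerAscents-extend : ∀ c → Above y c →
      Pointwise (Extends 0<y 0 0 c) (innerAscents y c) (map (2 +_) (increments (bars c)))
    innerAscents-extend (letter a) _        = []
    innerAscents-extend (a ▹ c) (y<a , ab) = lift-▹ y<a ab (innerAscents-extend c ab)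
    innerAscents-extend (a ∣ c) (y<a , ab) = extends-∣ 0<y y<a (front-▹ 0<y ab) ∷ lift-∣ y<a (innerAscents-extend c ab)

    innerPeaks-extend : ∀ c → Above y c →
      Pointwise (Extends 0<y 0 1 c) (innerPeaks y c) (map (2 +_) (increments (suc (bars c))))
    innerPeaks-extend (letter a) y<a       = final-peak 0<y y<a ∷ []
    innerPeaks-extend (a ▹ c) (y<a , ab) = lift-▹ y<a ab (innerPeaks-extend c ab)
    innerPeaks-extend (a ∣ c) (y<a , ab) = extends-∣ 0<y y<a (front-∣ 0<y ab) ∷ lift-∣ y<a (innerPeaks-extend c ab)

    ascendings-extend : ∀ c → Above y c → Pointwise (Extends₀ 0<y 0 0 c) (ascendings y c) (increments (suc (bars c)))
    ascendings-extend c ab = front-▹ 0<y ab ∷ Pointwise.map extends₀ (innerAscents-extend c ab)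

    peaks-extend : ∀ c → Above y c → Pointwise (Extends₀ 0<y 0 1 c) (peaks y c) (increments (suc (suc (bars c))))
    peaks-extend c ab = front-∣ 0<y ab ∷ Pointwise.map extends₀ (innerPeaks-extend c ab)

  -- Here y directly follows a larger letter and precedes a bar or the end of the word, so it is a
  -- double descent whatever stands before `c`.
  descents-dd : ∀ {y} c → Above y c → All (λ c′ → ∀ p → 1 ≤ ddᶜ p c′) (descents y c)
  descents-dd {y} (letter a) y<a = (λ p → ≤-trans (≤-reflexive (sym (𝟙-yes (y <? a) y<a))) (m≤n+m _ _)) ∷ []
  descents-dd (a ▹ c) (y<a , ab) = All.map⁺ (All.map (λ d p → ≤-trans (d a) (m≤n+m _ _)) (descents-dd c ab))
  descents-dd {y} (a ∣ c) (y<a , ab) =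
    (λ p → ≤-trans (≤-trans (≤-reflexive (sym (𝟙-yes (y <? a) y<a))) (m≤m+n (𝟙 (y <? a)) (ddᶜ 0 c)))
      (m≤n+m _ (𝟙 ((a <? p) ×-dec (y <? a))))) ∷
    All.map⁺ (All.map (λ d p → ≤-trans (d 0) (m≤n+m _ _)) (descents-dd c ab))

  -- One-line words as cut words without bars.

  run : (ℕ → ℕ) → ℕ → Cut
  run t zero    = letter (t 0)
  run t (suc m) = t 0 ▹ run (t ∘ suc) m

  first-run : ∀ t m → first (run t m) ≡ t 0
  first-run t zero    = refl
  first-run t (suc m) = refl

  des-run : ∀ t m → desᶜ (run t m) ≡ sum {m} (λ i → 𝟙 (t (suc (toℕ i)) <? t (toℕ i)))
  des-run t zero    = refl
  des-run t (suc m) = cong₂ _+_ (cong (λ f → 𝟙 (f <? t 0)) (first-run (t ∘ suc) m)) (des-run (t ∘ suc) m)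

  -- At the last letter `ddᶜ` omits the comparison with the boundary 0; `end` and `pos` restore it.
  dd-run : ∀ s m → s (2 + m) ≡ 0 → 0 < s (suc m) → ddᶜ (s 0) (run (s ∘ suc) m) ≡
    sum {suc m} (λ i → 𝟙 ((s (suc (toℕ i)) <? s (toℕ i)) ×-dec (s (2 + toℕ i) <? s (suc (toℕ i)))))
  dd-run s zero end pos = trans
    (𝟙-cong (s 1 <? s 0) ((s 1 <? s 0) ×-dec (s 2 <? s 1)) (λ lt → lt , subst (_< s 1) (sym end) pos) proj₁)
    (sym (+-identityʳ _))
  dd-run s (suc m) end pos = cong₂ _+_
    (cong (λ f → 𝟙 ((s 1 <? s 0) ×-dec (f <? s 1))) (first-run (λ i → s (2 + i)) m))
    (dd-run (s ∘ suc) m end pos)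

  between-run : ∀ l h t m → between l h (run t m) ≡ sum {suc m} (λ j → 𝟙 ((l <? t (toℕ j)) ×-dec (t (toℕ j) <? h)))
  between-run l h t zero    = sym (+-identityʳ _)
  between-run l h t (suc m) = cong (_ +_) (between-run l h (t ∘ suc) m)

  -- The sum has one term beyond the cut word, for the last letter and the boundary 0. It vanishes
  -- because nothing lies below 0.
  ascents-run : ∀ a s m → s (2 + m) ≡ 0 → ascents a (s 0) (run (s ∘ suc) m) ≡
    sum {2 + m} (λ i → 𝟙 ((s (toℕ i) <? a) ×-dec (a <? s (suc (toℕ i)))))
  ascents-run a s zero end = sym (trans
    (cong (λ x → 𝟙 ((s 0 <? a) ×-dec (a <? s 1)) + (x + 0))
      (𝟙-no ((s 1 <? a) ×-dec (a <? s 2)) λ (_ , lt) → n≮0 (subst (a <_) end lt)))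
    (+-identityʳ _))
  ascents-run a s (suc m) end = cong (_ +_) (ascents-run a (s ∘ suc) m end)

  31-2-run : ∀ t m → 31-2ᶜ (run t m) ≡ sum {suc m} (λ i → sum {suc m} (λ j →
    𝟙 ((suc (toℕ i) <? toℕ j) ×-dec (t (suc (toℕ i)) <? t (toℕ j)) ×-dec (t (toℕ j) <? t (toℕ i)))))
  31-2-run t zero    = refl
  31-2-run t (suc m) = cong₂ _+_
    (trans (cong (λ f → between f (t 0) (run (t ∘ suc) m)) (first-run (t ∘ suc) m))
      (trans (between-run (t 1) (t 0) (t ∘ suc) m)
        (sum-cong-≗ {suc m} λ j → 𝟙-cong ((t 1 <? t (suc (toℕ j))) ×-dec (t (suc (toℕ j)) <? t 0))
          ((1 <? suc (toℕ j)) ×-dec (t 1 <? t (suc (toℕ j))) ×-dec (t (suc (toℕ j)) <? t 0))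
          -- `j = 0` is the letter right after the leading one; it would have to exceed itself.
          (λ (a , b) → s≤s (n≢0⇒n>0 λ j≡0 → <-irrefl (cong (λ j → t (suc j)) (sym j≡0)) a) , a , b) proj₂)))
    (trans (31-2-run (t ∘ suc) m) (sum-cong-≗ {suc m} λ i → sum-cong-≗ {suc m} λ j →
      𝟙-cong ((suc (toℕ i) <? toℕ j) ×-dec (t (2 + toℕ i) <? t (suc (toℕ j))) ×-dec (t (suc (toℕ j)) <? t (suc (toℕ i))))
        ((2 + toℕ i <? suc (toℕ j)) ×-dec (t (2 + toℕ i) <? t (suc (toℕ j))) ×-dec (t (suc (toℕ j)) <? t (suc (toℕ i))))
        (λ (a , b) → s≤s a , b) (λ (a , b) → ≤-pred a , b)))

  2-13-run : ∀ t m → t (suc m) ≡ 0 → 2-13ᶜ (run t m) ≡ sum {suc m} (λ j → sum {suc m} (λ i →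
    𝟙 ((toℕ j <? toℕ i) ×-dec (t (toℕ i) <? t (toℕ j)) ×-dec (t (toℕ j) <? t (suc (toℕ i))))))
  2-13-run t zero    end = refl
  2-13-run t (suc m) end = cong₂ _+_
    (trans (ascents-run (t 0) t m end) (sum-cong-≗ {2 + m} λ i →
      𝟙-cong ((t (toℕ i) <? t 0) ×-dec (t 0 <? t (suc (toℕ i))))
        ((0 <? toℕ i) ×-dec (t (toℕ i) <? t 0) ×-dec (t 0 <? t (suc (toℕ i))))
        (λ (a , b) → n≢0⇒n>0 (λ i≡0 → <-irrefl (cong t i≡0) a) , a , b) proj₂))
    (trans (2-13-run (t ∘ suc) m end) (sum-cong-≗ {suc m} λ j → cong₂ _+_
      (sym (𝟙-no ((suc (toℕ j) <? 0) ×-dec (t 0 <? t (suc (toℕ j))) ×-dec (t (suc (toℕ j)) <? t 1)) λ ()))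
      (sum-cong-≗ {suc m} λ i →
        𝟙-cong ((toℕ j <? toℕ i) ×-dec (t (suc (toℕ i)) <? t (suc (toℕ j))) ×-dec (t (suc (toℕ j)) <? t (2 + toℕ i)))
          ((suc (toℕ j) <? suc (toℕ i)) ×-dec (t (suc (toℕ i)) <? t (suc (toℕ j))) ×-dec (t (suc (toℕ j)) <? t (2 + toℕ i)))
          (λ (a , b) → s≤s a , b) (λ (a , b) → ≤-pred a , b))))

  module _ {m} (σ : Permutation′ (suc m)) where

    private
      s t : ℕ → ℕ
      s = word σ
      t i = s (suc i)

      end : s (2 + m) ≡ 0
      end = word-end σ

      shift : ∀ i → s (suc i + 1) ≡ s (2 + i)
      shift i = cong s (+-comm (suc i) 1)

    des≡ : des σ ≡ desᶜ (run t m)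
    des≡ = trans
      (count-[1⋯] (λ i → s (i + 1) <? s i) m (λ i → t (suc (toℕ i)) <? t (toℕ i))
        (λ i → subst (_< t (toℕ i)) (shift (toℕ i))) (λ i → subst (_< t (toℕ i)) (sym (shift (toℕ i)))))
      (sym (des-run t m))

    dd≡ : dd σ ≡ ddᶜ 0 (run t m)
    dd≡ = trans
      (count-[1⋯] (λ i → (s i <? s (i ∸ 1)) ×-dec (s (i + 1) <? s i)) (suc m)
        (λ i → (s (suc (toℕ i)) <? s (toℕ i)) ×-dec (s (2 + toℕ i) <? s (suc (toℕ i))))
        (λ i (a , b) → a , subst (_< t (toℕ i)) (shift (toℕ i)) b)
        (λ i (a , b) → a , subst (_< t (toℕ i)) (sym (shift (toℕ i))) b))
      (sym (dd-run s m end (subst (0 <_) (sym last) (s≤s z≤n))))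
      where
      last : s (suc m) ≡ suc (val σ (fromℕ< ≤-refl))
      last = trans (cong (s ∘ suc) (sym (toℕ-fromℕ< (≤-refl {suc m})))) (word-suc σ (fromℕ< ≤-refl))

    31-2≡ : pat31-2 σ ≡ 31-2ᶜ (run t m)
    31-2≡ = trans
      (count-pairs (λ (i , j) → (i + 1 <? j) ×-dec (s (i + 1) <? s j) ×-dec (s j <? s i)) (suc m)
        (λ i j → (suc (toℕ i) <? toℕ j) ×-dec (t (suc (toℕ i)) <? t (toℕ j)) ×-dec (t (toℕ j) <? t (toℕ i)))
        (λ i j (a , b , c) → ≤-pred (subst (_< suc (toℕ j)) (+-comm (suc (toℕ i)) 1) a)
          , subst (_< t (toℕ j)) (shift (toℕ i)) b , c)
        (λ i j (a , b , c) → subst (_< suc (toℕ j)) (+-comm 1 (suc (toℕ i))) (s≤s a)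
          , subst (_< t (toℕ j)) (sym (shift (toℕ i))) b , c))
      (sym (31-2-run t m))

    2-13≡ : pat2-13 σ ≡ 2-13ᶜ (run t m)
    2-13≡ = trans
      (trans
        (count-pairs (λ (i , j) → (j <? i) ×-dec (i <? suc m) ×-dec (s i <? s j) ×-dec (s j <? s (i + 1))) (suc m)
          (λ i j → (toℕ j <? toℕ i) ×-dec (t (toℕ i) <? t (toℕ j)) ×-dec (t (toℕ j) <? t (suc (toℕ i))))
          (λ i j (a , _ , b , c) → ≤-pred a , b , subst (t (toℕ j) <_) (shift (toℕ i)) c)
          (λ i j (a , b , c) → s≤s a , not-last (toℕ i) (toℕ<n i) c , b , subst (t (toℕ j) <_) (sym (shift (toℕ i))) c))
        -- `pat2-13` puts the position of the 13 first, while `2-13-run` groups the patterns by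
        -- their 2.
        (∑-comm {suc m} {suc m} (λ i j →
          𝟙 ((toℕ j <? toℕ i) ×-dec (t (toℕ i) <? t (toℕ j)) ×-dec (t (toℕ j) <? t (suc (toℕ i)))))))
      (sym (2-13-run t m end))
      where
      not-last : ∀ {a} i → i < suc m → a < t (suc i) → suc i < suc m
      not-last {a} i (s≤s i≤m) lt = s≤s (≤∧≢⇒< i≤m λ { refl → n≮0 (subst (a <_) end lt) })

    stat≡ : 2 * pat31-2 σ + pat2-13 σ ≡ stat (run t m)
    stat≡ = cong₂ (λ a b → 2 * a + b) 31-2≡ 2-13≡

module Expansion {c ℓ} (R : CommutativeSemiring c ℓ) (q : CommutativeSemiring.Carrier R) where

  open Permutations
  open Cuts
  open import Data.Empty using (⊥)
  open import Data.Fin.Base using (Fin; zero; suc; toℕ; fromℕ<; punchIn)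
  open import Data.Fin.Permutation
    using (Permutation′; _⟨$⟩ʳ_; _⟨$⟩ˡ_; _≈_; insert; remove; inverseˡ; inverseʳ; insert-punchIn; insert-remove)
  import Data.Fin.Properties as Fin
  open import Data.List.Base using (List; []; _∷_; _++_; map; concatMap; foldr; filter; allFin; applyUpTo; tabulate)
  open import Data.List.Membership.Propositional.Properties using (∈-allFin)
  open import Data.List.Properties using (map-tabulate; map-applyUpTo)
  open import Data.List.Relation.Binary.Pointwise as Pointwise using (Pointwise; []; _∷_)
  open import Data.List.Relation.Unary.All as All using (All; []; _∷_)
  open import Data.List.Relation.Unary.AllPairs as AllPairs using (AllPairs; []; _∷_)
  open import Data.List.Relation.Unary.Any as Any using (Any; here; there)
  open import Data.List.Relation.Unary.Unique.Propositional.Properties using (allFin⁺)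
  import Data.List.Relation.Unary.All.Properties as All
  import Data.List.Relation.Unary.AllPairs.Properties as AllPairs
  import Data.List.Relation.Unary.Any.Properties as Any
  open import Data.Nat.Base using (zero; suc; _+_; _∸_; _≤_; z≤n; s≤s)
  open import Data.Nat.Properties as ℕ using (_<?_; _≟_)
  open import Data.Product.Base using (_,_; proj₁; proj₂; ∃₂)
  open import Data.Sum.Base using (_⊎_; inj₁; inj₂)
  open import Data.Vec.Base as Vec using (Vec; []; _∷_; insertAt)
  open import Data.Vec.Properties using (tabulate-cong)
  open import Data.Vec.Relation.Unary.All as Vec using ([]; _∷_)
  open import Data.Vec.Relation.Unary.All.Properties using (tabulate⁺)
  open import Function.Base using (_∘_; id)
  open import Relation.Binary.PropositionalEquality.Core as ≡ using (_≡_; _≢_)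
  open import Relation.Nullary.Decidable.Core using (Dec; yes; no; _×-dec_)
  open import Relation.Nullary.Negation.Core using (¬_; contradiction)
  open import Relation.Unary using (Pred; Decidable)
  open import Algebra.Properties.CommutativeMonoid.Sum ℕ.+-0-commutativeMonoid using (sum-cong-≗)

  open CommutativeSemiring R
    using (Carrier; 0#; 1#; setoid; semiring; refl; sym; trans; reflexive; +-cong; +-congˡ; +-congʳ; *-congˡ; *-congʳ;
           +-identityˡ; +-identityʳ; +-assoc; +-comm; distribˡ; distribʳ; zeroˡ; zeroʳ; *-assoc; *-comm; *-identityˡ)
    renaming (_≈_ to _≋_; _+_ to _⊕_; _*_ to _⊗_)
  open import Algebra.Properties.CommutativeSemigroup (CommutativeSemiring.+-commutativeSemigroup R) using (interchange)
  open import Algebra.Properties.Semiring.Exp semiring using (_^_; ^-homo-*; ^-congʳ)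
  open import Relation.Binary.Reasoning.Setoid setoid
  open Enumerators R q

  -- Finite sums in the semiring.

  ∑ : ∀ {a} {A : Set a} → List A → (A → Carrier) → Carrier
  ∑ xs f = foldr _⊕_ 0# (map f xs)

  module _ {a} {A : Set a} where

    ∑-congᴬ : ∀ {f g : A → Carrier} {xs} → All (λ x → f x ≋ g x) xs → ∑ xs f ≋ ∑ xs g
    ∑-congᴬ []         = refl
    ∑-congᴬ (eq ∷ eqs) = +-cong eq (∑-congᴬ eqs)

    ∑-cong : ∀ {f g : A → Carrier} → (∀ x → f x ≋ g x) → ∀ xs → ∑ xs f ≋ ∑ xs g
    ∑-cong eq xs = ∑-congᴬ (All.universal eq xs)

    ∑-0 : ∀ (xs : List A) → ∑ xs (λ _ → 0#) ≋ 0#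
    ∑-0 []       = refl
    ∑-0 (x ∷ xs) = trans (+-identityˡ _) (∑-0 xs)

    ∑-++ : ∀ (f : A → Carrier) xs ys → ∑ (xs ++ ys) f ≋ ∑ xs f ⊕ ∑ ys f
    ∑-++ f []       ys = sym (+-identityˡ _)
    ∑-++ f (x ∷ xs) ys = trans (+-congˡ (∑-++ f xs ys)) (sym (+-assoc _ _ _))

    ∑-⊕ : ∀ (f g : A → Carrier) xs → ∑ xs (λ x → f x ⊕ g x) ≋ ∑ xs f ⊕ ∑ xs g
    ∑-⊕ f g []       = sym (+-identityˡ _)
    ∑-⊕ f g (x ∷ xs) = trans (+-congˡ (∑-⊕ f g xs)) (interchange _ _ _ _)

    ∑-⊗ˡ : ∀ r (f : A → Carrier) xs → ∑ xs (λ x → r ⊗ f x) ≋ r ⊗ ∑ xs f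
    ∑-⊗ˡ r f []       = sym (zeroʳ r)
    ∑-⊗ˡ r f (x ∷ xs) = trans (+-congˡ (∑-⊗ˡ r f xs)) (sym (distribˡ r _ _))

    ∑-⊗ʳ : ∀ r (f : A → Carrier) xs → ∑ xs (λ x → f x ⊗ r) ≋ ∑ xs f ⊗ r
    ∑-⊗ʳ r f []       = sym (zeroˡ r)
    ∑-⊗ʳ r f (x ∷ xs) = trans (+-congˡ (∑-⊗ʳ r f xs)) (sym (distribʳ r _ _))

  module _ {a b} {A : Set a} {B : Set b} where

    ∑-map : ∀ (f : B → Carrier) (g : A → B) xs → ∑ (map g xs) f ≋ ∑ xs (f ∘ g)
    ∑-map f g []       = refl
    ∑-map f g (x ∷ xs) = +-congˡ (∑-map f g xs)

    ∑-concatMap : ∀ (f : B → Carrier) (g : A → List B) xs → ∑ (concatMap g xs) f ≋ ∑ xs (λ x → ∑ (g x) f)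
    ∑-concatMap f g []       = refl
    ∑-concatMap f g (x ∷ xs) = trans (∑-++ f (g x) _) (+-congˡ (∑-concatMap f g xs))

    ∑-comm : ∀ (f : A → B → Carrier) xs ys → ∑ xs (λ x → ∑ ys (f x)) ≋ ∑ ys (λ y → ∑ xs (λ x → f x y))
    ∑-comm f []       ys = sym (∑-0 ys)
    ∑-comm f (x ∷ xs) ys = trans (+-congˡ (∑-comm f xs ys)) (sym (∑-⊕ (f x) _ ys))

  ∑-allFin-suc : ∀ {n} (f : Fin (suc n) → Carrier) → ∑ (allFin (suc n)) f ≋ f zero ⊕ ∑ (allFin n) (f ∘ suc)
  ∑-allFin-suc {n} f = +-congˡ (begin
    ∑ (tabulate suc) f  ≡⟨ ≡.cong (λ xs → ∑ xs f) (map-tabulate id suc) ⟨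
    ∑ (map suc (allFin n)) f           ≈⟨ ∑-map f suc (allFin n) ⟩
    ∑ (allFin n) (f ∘ suc)             ∎)

  -- Filters are turned into vanishing terms, so that every sum ranges over a full list `perms n`
  -- and can be reindexed.
  guard : ∀ {p} {P : Set p} → Dec P → Carrier → Carrier
  guard (yes _) r = r
  guard (no _)  r = 0#

  module _ {p} {P : Set p} where

    guard-yes : (P? : Dec P) → P → ∀ {r} → guard P? r ≋ r
    guard-yes (yes _) _ = refl
    guard-yes (no ¬p) p = contradiction p ¬p

    guard-no : (P? : Dec P) → ¬ P → ∀ {r} → guard P? r ≋ 0#
    guard-no (yes p) ¬p = contradiction p ¬p
    guard-no (no _)  _  = refl

    guard-⊗ : (P? : Dec P) → ∀ r s → guard P? (r ⊗ s) ≋ r ⊗ guard P? s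
    guard-⊗ (yes _) r s = refl
    guard-⊗ (no _)  r s = sym (zeroʳ r)

  guard-cong : ∀ {p q} {P : Set p} {Q : Set q} (P? : Dec P) (Q? : Dec Q) →
    (P → Q) → (Q → P) → ∀ {r s} → (P → r ≋ s) → guard P? r ≋ guard Q? s
  guard-cong (yes p) (yes _) _ _ r≋s = r≋s p
  guard-cong (yes p) (no ¬q) f _ _   = contradiction (f p) ¬q
  guard-cong (no ¬p) (yes q) _ g _   = contradiction (g q) ¬p
  guard-cong (no _)  (no _)  _ _ _   = refl

  guard-split : ∀ {p q s} {P : Set p} {Q : Set q} {S : Set s} (P? : Dec P) (Q? : Dec Q) (S? : Dec S) →
    (Q → P) → (S → P) → (P → Q ⊎ S) → (Q → S → ⊥) → ∀ {r} → guard P? r ≋ guard Q? r ⊕ guard S? r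
  guard-split (yes p) (yes q) (yes s) _ _ _ d = contradiction s (d q)
  guard-split (yes p) (yes _) (no _)  _ _ _ _ = sym (+-identityʳ _)
  guard-split (yes p) (no _)  (yes _) _ _ _ _ = sym (+-identityˡ _)
  guard-split (yes p) (no ¬q) (no ¬s) _ _ c _ with c p
  ... | inj₁ q = contradiction q ¬q
  ... | inj₂ s = contradiction s ¬s
  guard-split (no ¬p) (yes q) _       f _ _ _ = contradiction (f q) ¬p
  guard-split (no ¬p) (no _)  (yes s) _ g _ _ = contradiction (g s) ¬p
  guard-split (no _)  (no _)  (no _)  _ _ _ _ = sym (+-identityˡ _)

  ∑-filter : ∀ {a p} {A : Set a} {P : Pred A p} (P? : Decidable P) (f : A → Carrier) xs →
    ∑ (filter P? xs) f ≋ ∑ xs (λ x → guard (P? x) (f x))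
  ∑-filter P? f [] = refl
  ∑-filter P? f (x ∷ xs) with P? x
  ... | yes _ = +-congˡ (∑-filter P? f xs)
  ... | no  _ = trans (∑-filter P? f xs) (sym (+-identityˡ _))

  ∑-guard-< : ∀ {n m} → m ≤ n → (f : ℕ → ℕ) (g : ℕ → Carrier) →
    ∑ (allFin n) (λ i → guard (toℕ i <? m) (g (f (toℕ i)))) ≋ ∑ (applyUpTo f m) g
  ∑-guard-< {n} {zero} z≤n f g =
    trans (∑-cong (λ i → guard-no (toℕ i <? 0) (λ ()) {g (f (toℕ i))}) (allFin n)) (∑-0 (allFin n))
  ∑-guard-< {suc n} {suc m} (s≤s m≤n) f g = trans (∑-allFin-suc {n} (λ i → guard (toℕ i <? suc m) (g (f (toℕ i)))))
    (+-cong (guard-yes (0 <? suc m) (s≤s z≤n) {g (f 0)})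
      (trans (∑-cong (λ i → guard-cong (suc (toℕ i) <? suc m) (toℕ i <? m) (λ { (s≤s lt) → lt }) s≤s (λ _ → refl))
        (allFin n))
        (∑-guard-< m≤n (f ∘ suc) g)))

  module _ {a r} {A : Set a} {_~_ : A → A → Set r} (_~?_ : ∀ x y → Dec (x ~ y))
           (~-sym : ∀ {x y} → x ~ y → y ~ x) (~-trans : ∀ {x y z} → x ~ y → y ~ z → x ~ z)
           (f : A → Carrier) (f-cong : ∀ {x y} → x ~ y → f x ≋ f y) where

    private
      distinct : List A → Set _
      distinct = AllPairs (λ x y → ¬ x ~ y)

    ∑-pick : ∀ x ys → distinct ys → Any (x ~_) ys → ∑ ys (λ y → guard (x ~? y) (f y)) ≋ f x
    ∑-pick x (y ∷ ys) (y≁ ∷ _) (here x~y) = begin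
      guard (x ~? y) (f y) ⊕ ∑ ys (λ z → guard (x ~? z) (f z))
        ≈⟨ +-cong (trans (guard-yes (x ~? y) x~y) (sym (f-cong x~y)))
             (trans (∑-congᴬ (All.map (λ y≁z → guard-no (x ~? _) λ x~z → y≁z (~-trans (~-sym x~y) x~z)) y≁)) (∑-0 ys)) ⟩
      f x ⊕ 0#  ≈⟨ +-identityʳ _ ⟩
      f x       ∎
    ∑-pick x (y ∷ ys) (y≁ ∷ d) (there x~) = trans
      (+-cong (guard-no (x ~? y) (λ x~y →
        All.lookupAny y≁ x~ .proj₁ (~-trans (~-sym x~y) (All.lookupAny y≁ x~ .proj₂))))
          (∑-pick x ys d x~))
      (+-identityˡ _)

    -- Both lists meet each class of `~` exactly once, so either sum equals the double sum over the
    -- pairs x ~ y.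
    ∑-reindex : ∀ {xs ys} → distinct xs → distinct ys → (∀ x → Any (x ~_) xs) → (∀ x → Any (x ~_) ys) → ∑ xs f ≋ ∑ ys f
    ∑-reindex {xs} {ys} dx dy cx cy = begin
      ∑ xs f                                                ≈⟨ ∑-cong (λ x → ∑-pick x ys dy (cy x)) xs ⟨
      ∑ xs (λ x → ∑ ys (λ y → guard (x ~? y) (f y)))        ≈⟨ ∑-comm (λ x y → guard (x ~? y) (f y)) xs ys ⟩
      ∑ ys (λ y → ∑ xs (λ x → guard (x ~? y) (f y)))
        ≈⟨ ∑-cong (λ y → ∑-cong (λ x → guard-cong (x ~? y) (y ~? x) ~-sym ~-sym (λ x~y → sym (f-cong x~y))) xs) ys ⟩
      ∑ ys (λ y → ∑ xs (λ x → guard (y ~? x) (f x)))        ≈⟨ ∑-cong (λ y → ∑-pick y xs dx (cx y)) ys ⟩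
      ∑ ys f                                                ∎

  -- Sums over all permutations, by position and by value.

  Respects≈ : ∀ {n} → (Permutation′ n → Carrier) → Set _
  Respects≈ f = ∀ {σ τ} → σ ≈ τ → f σ ≋ f τ

  _≈?_ : ∀ {n} (σ τ : Permutation′ n) → Dec (σ ≈ τ)
  σ ≈? τ = Fin.all? λ i → (σ ⟨$⟩ʳ i) Fin.≟ (τ ⟨$⟩ʳ i)

  insert-congᵖ : ∀ {n} p v {σ τ : Permutation′ n} → σ ≈ τ → insert p v σ ≈ insert p v τ
  insert-congᵖ p v {σ} {τ} σ≈τ x with insertView p x
  ... | at     = ≡.trans (insert-at p v σ) (≡.sym (insert-at p v τ))
  ... | away i = ≡.trans (insert-punchIn p v σ i)
    (≡.trans (≡.cong (punchIn v) (σ≈τ i)) (≡.sym (insert-punchIn p v τ i)))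

  insert-injectiveᵖ : ∀ {n} p v w {σ τ : Permutation′ n} → insert p v σ ≈ insert p w τ → v ≡ w × σ ≈ τ
  insert-injectiveᵖ p v w {σ} {τ} eq = v≡w , λ i → Fin.punchIn-injective v _ _ (≡.trans
      (≡.sym (insert-punchIn p v σ i)) (≡.trans (eq (punchIn p i))
      (≡.trans (insert-punchIn p w τ i) (≡.cong (λ v → punchIn v (τ ⟨$⟩ʳ i)) (≡.sym v≡w)))))
    where
    v≡w : v ≡ w
    v≡w = ≡.trans (≡.sym (insert-at p v σ)) (≡.trans (eq p) (insert-at p w τ))

  module _ {n} (ins : Fin (suc n) → Permutation′ n → Permutation′ (suc n))
           (ins-cong : ∀ j {σ τ} → σ ≈ τ → ins j σ ≈ ins j τ)
           (ins-injective : ∀ i j {σ τ} → ins i σ ≈ ins j τ → i ≡ j × σ ≈ τ)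
           (ins-surjective : ∀ σ → ∃₂ λ j τ → σ ≈ ins j τ) where

    -- The hypotheses on `ins` say that it, too, builds every permutation once up to `≈`, so it may
    -- replace the insertion at the first position used by `perms`.
    ∑-perms-suc : ∀ f → Respects≈ f → ∑ (perms (suc n)) f ≋ ∑ (allFin (suc n)) (λ j → ∑ (perms n) (f ∘ ins j))
    ∑-perms-suc f f-cong = begin
      ∑ (perms (suc n)) f
        ≈⟨ ∑-reindex _≈?_ (λ eq i → ≡.sym (eq i)) (λ eq eq′ i → ≡.trans (eq i) (eq′ i)) f f-cong
             (perms-distinct (suc n)) distinct (perms-complete (suc n)) complete ⟩
      ∑ (concatMap (λ j → map (ins j) (perms n)) (allFin (suc n))) f
        ≈⟨ ∑-concatMap f (λ j → map (ins j) (perms n)) (allFin (suc n)) ⟩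
      ∑ (allFin (suc n)) (λ j → ∑ (map (ins j) (perms n)) f)
        ≈⟨ ∑-cong (λ j → ∑-map f (ins j) (perms n)) (allFin (suc n)) ⟩
      ∑ (allFin (suc n)) (λ j → ∑ (perms n) (f ∘ ins j)) ∎
      where
      distinct : AllPairs (λ σ τ → ¬ σ ≈ τ) (concatMap (λ j → map (ins j) (perms n)) (allFin (suc n)))
      distinct = AllPairs.concat⁺
        (All.map⁺ (All.universal
          (λ j → AllPairs.map⁺ (AllPairs.map (λ σ≉τ eq → σ≉τ (ins-injective j j eq .proj₂)) (perms-distinct n)))
          (allFin (suc n))))
        (AllPairs.map⁺ (AllPairs.map
          (λ {i} {j} i≢j → All.map⁺ (All.universal (λ _ → All.map⁺ (All.universal
            (λ _ eq → i≢j (ins-injective i j eq .proj₁)) (perms n))) (perms n)))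
          (allFin⁺ (suc n))))
      complete : ∀ σ → Any (σ ≈_) (concatMap (λ j → map (ins j) (perms n)) (allFin (suc n)))
      complete σ with ins-surjective σ
      ... | j , τ , eq = Any.concat⁺ (Any.map⁺ (Any.map
        (λ { ≡.refl → Any.map⁺ (Any.map (λ τ≈τ′ i → ≡.trans (eq i) (ins-cong j τ≈τ′ i)) (perms-complete n τ)) })
        (∈-allFin j)))

  ∑-insert-position : ∀ {n} (p : Fin (suc n)) f → Respects≈ f →
    ∑ (perms (suc n)) f ≋ ∑ (allFin (suc n)) (λ v → ∑ (perms n) (λ τ → f (insert p v τ)))
  ∑-insert-position p = ∑-perms-suc (insert p) (λ v {σ} {τ} → insert-congᵖ p v {σ} {τ})
    (λ v w {σ} {τ} → insert-injectiveᵖ p v w {σ} {τ})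
    (λ σ → σ ⟨$⟩ʳ p , remove p σ , λ i → ≡.sym (insert-remove p σ i))

  ∑-insert-value : ∀ {n} (v : Fin (suc n)) f → Respects≈ f →
    ∑ (perms (suc n)) f ≋ ∑ (allFin (suc n)) (λ p → ∑ (perms n) (λ τ → f (insert p v τ)))
  ∑-insert-value v = ∑-perms-suc (λ p → insert p v) (λ p {σ} {τ} → insert-congᵖ p v {σ} {τ}) injective surjective
    where
    injective : ∀ p p′ {σ τ} → insert p v σ ≈ insert p′ v τ → p ≡ p′ × σ ≈ τ
    injective p p′ {σ} {τ} eq with insertView p p′
    ... | at     = ≡.refl , insert-injectiveᵖ p v v {σ} {τ} eq .proj₂
    ... | away i = contradiction
      (≡.trans (≡.sym (insert-punchIn p v σ i)) (≡.trans (eq (punchIn p i)) (insert-at (punchIn p i) v τ)))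
      (Fin.punchInᵢ≢i v _)
    surjective : ∀ σ → ∃₂ λ p τ → σ ≈ insert p v τ
    surjective σ = σ ⟨$⟩ˡ v , remove (σ ⟨$⟩ˡ v) σ , λ i →
      ≡.sym (≡.subst (λ w → insert (σ ⟨$⟩ˡ v) w (remove (σ ⟨$⟩ˡ v) σ) ⟨$⟩ʳ i ≡ σ ⟨$⟩ʳ i)
        (inverseʳ σ) (insert-remove (σ ⟨$⟩ˡ v) σ i))

  val-cong : ∀ {n} {σ τ : Permutation′ n} → σ ≈ τ → ∀ i → val σ i ≡ val τ i
  val-cong σ≈τ i = ≡.cong toℕ (σ≈τ i)

  inv-cong : ∀ {n} (σ τ : Permutation′ n) → σ ≈ τ → inv σ ≡ inv τ
  inv-cong {n} σ τ σ≈τ = ≡.trans (inv-sum σ) (≡.trans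
    (sum-cong-≗ {n} λ i → sum-cong-≗ {n} λ j → ≡.cong₂ (λ a b → 𝟙 ((toℕ i <? toℕ j) ×-dec (a <? b)))
      (val-cong {σ = σ} {τ} σ≈τ j) (val-cong {σ = σ} {τ} σ≈τ i))
    (≡.sym (inv-sum τ)))

  exc-cong : ∀ {n} (σ τ : Permutation′ n) → σ ≈ τ → exc σ ≡ exc τ
  exc-cong {n} σ τ σ≈τ = ≡.trans (exc-sum σ) (≡.trans
    (sum-cong-≗ {n} λ i → ≡.cong (λ a → 𝟙 (toℕ i <? a)) (val-cong {σ = σ} {τ} σ≈τ i))
    (≡.sym (exc-sum τ)))

  good-cong : ∀ {u l n} (σ τ : Permutation′ n) → σ ≈ τ → Good u l σ → Good u l τ
  good-cong {u} {l} σ τ σ≈τ (high , nodrop) =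
    (λ i i<u → ≡.subst (l ≤_) (eq i) (high i i<u)) ,
    (λ i j u≤i i<τi τj → nodrop i j u≤i (≡.subst (toℕ i <_) (≡.sym (eq i)) i<τi) (≡.trans (eq j) τj))
    where
    eq : ∀ i → val σ i ≡ val τ i
    eq = val-cong {σ = σ} {τ} σ≈τ

  from-cong : ∀ {n} (σ τ : Permutation′ n) → σ ≈ τ → ∀ i → σ ⟨$⟩ˡ i ≡ τ ⟨$⟩ˡ i
  from-cong σ τ σ≈τ i = ≡.trans (≡.cong (σ ⟨$⟩ˡ_) (≡.trans (≡.sym (inverseʳ τ)) (≡.sym (σ≈τ (τ ⟨$⟩ˡ i)))))
    (inverseˡ σ)

  -- Recurrences for the excedance sums.

  w : ℕ → Carrier
  w u = ∑ (applyUpTo (u +_) (suc u)) (q ^_)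

  -- The contribution of a down step, which uses up one unit of `k`: a completed excedance on one
  -- side, the additional descent of a peak on the other.
  down : (ℕ → ℕ → Carrier) → ℕ → ℕ → Carrier
  down f zero    k       = 0#
  down f (suc u) zero    = 0#
  down f (suc u) (suc k) = f u k

  weight : ∀ {n} → Permutation′ n → Carrier
  weight σ = q ^ inv-exc σ

  weight-cong : ∀ {n} (σ τ : Permutation′ n) → σ ≈ τ → weight σ ≋ weight τ
  weight-cong σ τ σ≈τ = ^-congʳ q (≡.cong₂ _∸_ (inv-cong σ τ σ≈τ) (exc-cong σ τ σ≈τ))

  goodExc? : ∀ u l k {n} (σ : Permutation′ n) → Dec (exc σ ≡ k × Good u l σ)
  goodExc? u l k σ = (exc σ ≟ k) ×-dec good? u l σ

  goodExc-cong : ∀ {u l k n} (σ τ : Permutation′ n) → σ ≈ τ → exc σ ≡ k × Good u l σ → exc τ ≡ k × Good u l τ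
  goodExc-cong σ τ σ≈τ (e , g) = ≡.trans (≡.sym (exc-cong σ τ σ≈τ)) e , good-cong σ τ σ≈τ g

  ≈-sym : ∀ {n} {σ τ : Permutation′ n} → σ ≈ τ → τ ≈ σ
  ≈-sym σ≈τ i = ≡.sym (σ≈τ i)

  GoodSum : ℕ → ℕ → ℕ → ℕ → Carrier
  GoodSum u l n k = ∑ (perms n) (λ σ → guard (goodExc? u l k σ) (weight σ))

  module _ {n u k : ℕ} (u≤n : u ≤ n) where

    private
      p : Fin (suc n)
      p = fromℕ< (s≤s u≤n)

      p≡u : toℕ p ≡ u
      p≡u = Fin.toℕ-fromℕ< (s≤s u≤n)

      closes? : (σ : Permutation′ (suc n)) → Dec (val σ p < suc u × exc σ ≡ k × Good u (suc u) σ)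
      closes? σ = (val σ p <? suc u) ×-dec goodExc? u (suc u) k σ

      closes-cong : Respects≈ (λ σ → guard (closes? σ) (weight σ))
      closes-cong {σ} {τ} σ≈τ = guard-cong (closes? σ) (closes? τ)
        (λ (lt , g) → ≡.subst (_< suc u) (val-cong {σ = σ} {τ} σ≈τ p) lt , goodExc-cong σ τ σ≈τ g)
        (λ (lt , g) → ≡.subst (_< suc u) (≡.sym (val-cong {σ = σ} {τ} σ≈τ p)) lt
                    , goodExc-cong τ σ (≈-sym {σ = σ} {τ} σ≈τ) g)
        (λ _ → weight-cong σ τ σ≈τ)

      exc-eq : ∀ v τ → toℕ v ≤ u → Good u u τ → exc (insert p v τ) ≡ exc τ
      exc-eq v τ v≤u (high , _) = ≡.trans
        (exc-insert p v τ (λ i i<p → ℕ.≤-trans v≤u (high i (≡.subst (toℕ i <_) p≡u i<p)))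
          (λ i i<p → ℕ.<-≤-trans (≡.subst (toℕ i <_) p≡u i<p) (high i (≡.subst (toℕ i <_) p≡u i<p)))
          (λ i τi<v → ℕ.≮⇒≥ λ i<τi → ℕ.<⇒≱ τi<v (ℕ.≤-trans v≤u (high i (ℕ.<-trans i<τi (ℕ.<-≤-trans τi<v v≤u))))))
        (≡.cong (_+ exc τ) (𝟙-no (toℕ p <? toℕ v) (ℕ.≤⇒≯ (ℕ.≤-trans v≤u (ℕ.≤-reflexive (≡.sym p≡u))))))

      -- The new pair adds u + v inversions and, as v ≤ u, no excedance. By `exc≤inv` the truncated
      -- subtraction is additive.
      weight-eq : ∀ v τ → toℕ v ≤ u → Good u u τ → weight (insert p v τ) ≋ q ^ (u + toℕ v) ⊗ weight τ
      weight-eq v τ v≤u g@(high , _) = trans (^-congʳ q eq) (^-homo-* q (u + toℕ v) (inv-exc τ))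
        where
        eq : inv-exc (insert p v τ) ≡ u + toℕ v + inv-exc τ
        eq = ≡.trans (≡.cong₂ _∸_
            (inv-insert p v τ λ i i<p → ℕ.≤-trans v≤u (high i (≡.subst (toℕ i <_) p≡u i<p)))
            (exc-eq v τ v≤u g))
          (≡.trans (≡.cong (λ a → a + inv τ ∸ exc τ) (≡.trans (≡.cong (toℕ v +_) p≡u) (ℕ.+-comm (toℕ v) u)))
            (ℕ.+-∸-assoc (u + toℕ v) (exc≤inv τ)))

      closes-insert : ∀ v τ → guard (closes? (insert p v τ)) (weight (insert p v τ)) ≋
        guard (toℕ v <? suc u) (q ^ (u + toℕ v)) ⊗ guard (goodExc? u u k τ) (weight τ)
      closes-insert v τ with toℕ v <? suc u
      ... | no v≰u = trans (guard-no (closes? (insert p v τ)) λ (lt , _) → v≰u (≡.subst (_< suc u) (val-at p v τ) lt))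
        (sym (zeroˡ _))
      ... | yes (s≤s v≤u) = trans
        (guard-cong (closes? (insert p v τ)) (goodExc? u u k τ)
          (λ (_ , e , g) → let g′ = good-close-position p v τ p≡u v≤u g in ≡.trans (≡.sym (exc-eq v τ v≤u g′)) e , g′)
          (λ (e , g) → s≤s (ℕ.≤-trans (ℕ.≤-reflexive (val-at p v τ)) v≤u) , ≡.trans (exc-eq v τ v≤u g) e
                     , good-close-position⁻ p v τ p≡u v≤u g)
          (λ (_ , _ , g) → weight-eq v τ v≤u (good-close-position p v τ p≡u v≤u g)))
        (guard-⊗ (goodExc? u u k τ) _ _)

    -- Either position u carries a value above u and becomes open at no cost, or it carries some v ≤
    -- u and is removed with it. The factors q^(u+v) for v = 0, ..., u add up to `w u`.
    GoodSum-position : GoodSum u (suc u) (suc n) k ≋ GoodSum (suc u) (suc (suc u)) (suc n) k ⊕ w u ⊗ GoodSum u u n k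
    GoodSum-position = begin
      GoodSum u (suc u) (suc n) k
        ≈⟨ ∑-cong split (perms (suc n)) ⟩
      ∑ (perms (suc n)) (λ σ → guard (goodExc? (suc u) (suc (suc u)) k σ) (weight σ) ⊕ guard (closes? σ) (weight σ))
        ≈⟨ ∑-⊕ (λ σ → guard (goodExc? (suc u) (suc (suc u)) k σ) (weight σ)) (λ σ → guard (closes? σ) (weight σ))
          (perms (suc n)) ⟩
      GoodSum (suc u) (suc (suc u)) (suc n) k ⊕ ∑ (perms (suc n)) (λ σ → guard (closes? σ) (weight σ))
        ≈⟨ +-congˡ closing ⟩
      GoodSum (suc u) (suc (suc u)) (suc n) k ⊕ w u ⊗ GoodSum u u n k ∎
      where
      split : ∀ σ → guard (goodExc? u (suc u) k σ) (weight σ) ≋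
        guard (goodExc? (suc u) (suc (suc u)) k σ) (weight σ) ⊕ guard (closes? σ) (weight σ)
      split σ = guard-split (goodExc? u (suc u) k σ) (goodExc? (suc u) (suc (suc u)) k σ) (closes? σ)
        (λ (e , g) → e , good-open⁻ u p p≡u σ g .proj₁)
        (λ (_ , e , g) → e , g)
        (λ (e , g) → cases e g (u <? val σ p))
        (λ (_ , g) (lt , _) → ℕ.<⇒≱ (good-open⁻ u p p≡u σ g .proj₂) (ℕ.≤-pred lt))
        where
        cases : exc σ ≡ k → Good u (suc u) σ → Dec (u < val σ p) →
          (exc σ ≡ k × Good (suc u) (suc (suc u)) σ) ⊎ (val σ p < suc u × exc σ ≡ k × Good u (suc u) σ)
        cases e g (yes lt) = inj₁ (e , good-open u p p≡u σ g lt)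
        cases e g (no ≮)   = inj₂ (s≤s (ℕ.≮⇒≥ ≮) , e , g)
      closing : ∑ (perms (suc n)) (λ σ → guard (closes? σ) (weight σ)) ≋ w u ⊗ GoodSum u u n k
      closing = begin
        ∑ (perms (suc n)) (λ σ → guard (closes? σ) (weight σ))
          ≈⟨ ∑-insert-position p _ (λ {σ} {τ} → closes-cong {σ} {τ}) ⟩
        ∑ (allFin (suc n)) (λ v → ∑ (perms n) (λ τ → guard (closes? (insert p v τ)) (weight (insert p v τ))))
          ≈⟨ ∑-cong (λ v → trans (∑-cong (closes-insert v) (perms n))
               (∑-⊗ˡ (guard (toℕ v <? suc u) (q ^ (u + toℕ v))) (λ τ → guard (goodExc? u u k τ) (weight τ)) (perms n)))
                 (allFin (suc n)) ⟩
        ∑ (allFin (suc n)) (λ v → guard (toℕ v <? suc u) (q ^ (u + toℕ v)) ⊗ GoodSum u u n k)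
          ≈⟨ ∑-⊗ʳ (GoodSum u u n k) (λ v → guard (toℕ v <? suc u) (q ^ (u + toℕ v))) (allFin (suc n)) ⟩
        ∑ (allFin (suc n)) (λ v → guard (toℕ v <? suc u) (q ^ (u + toℕ v))) ⊗ GoodSum u u n k
          ≈⟨ *-congʳ (∑-guard-< (s≤s u≤n) (u +_) (q ^_)) ⟩
        w u ⊗ GoodSum u u n k ∎

  module _ {n u : ℕ} (u≤n : u ≤ n) where

    private
      v : Fin (suc n)
      v = fromℕ< (s≤s u≤n)

      v≡u : toℕ v ≡ u
      v≡u = Fin.toℕ-fromℕ< (s≤s u≤n)

      fills? : ∀ k (σ : Permutation′ (suc n)) → Dec (toℕ (σ ⟨$⟩ˡ v) < u × exc σ ≡ k × Good u u σ)
      fills? k σ = (toℕ (σ ⟨$⟩ˡ v) <? u) ×-dec goodExc? u u k σ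

      fills-cong : ∀ k → Respects≈ (λ σ → guard (fills? k σ) (weight σ))
      fills-cong k {σ} {τ} σ≈τ = guard-cong (fills? k σ) (fills? k τ)
        (λ (lt , g) → ≡.subst (_< u) (≡.cong toℕ (from-cong σ τ σ≈τ v)) lt , goodExc-cong σ τ σ≈τ g)
        (λ (lt , g) → ≡.subst (_< u) (≡.cong toℕ (≡.sym (from-cong σ τ σ≈τ v))) lt
                    , goodExc-cong τ σ (≈-sym {σ = σ} {τ} σ≈τ) g)
        (λ _ → weight-cong σ τ σ≈τ)

    GoodSum-split : ∀ k → GoodSum u u (suc n) k ≋
      GoodSum u (suc u) (suc n) k ⊕ ∑ (perms (suc n)) (λ σ → guard (fills? k σ) (weight σ))
    GoodSum-split k = trans (∑-cong split (perms (suc n)))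
      (∑-⊕ (λ σ → guard (goodExc? u (suc u) k σ) (weight σ)) (λ σ → guard (fills? k σ) (weight σ)) (perms (suc n)))
      where
      split : ∀ σ → guard (goodExc? u u k σ) (weight σ) ≋
        guard (goodExc? u (suc u) k σ) (weight σ) ⊕ guard (fills? k σ) (weight σ)
      split σ = guard-split (goodExc? u u k σ) (goodExc? u (suc u) k σ) (fills? k σ)
        (λ (e , g) → e , good-skip⁻ u v v≡u σ g .proj₁)
        (λ (_ , e , g) → e , g)
        (λ (e , g) → cases e g (toℕ (σ ⟨$⟩ˡ v) <? u))
        (λ (_ , g) (lt , _) → ℕ.<⇒≱ lt (good-skip⁻ u v v≡u σ g .proj₂))
        where
        cases : exc σ ≡ k → Good u u σ → Dec (toℕ (σ ⟨$⟩ˡ v) < u) →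
          (exc σ ≡ k × Good u (suc u) σ) ⊎ (toℕ (σ ⟨$⟩ˡ v) < u × exc σ ≡ k × Good u u σ)
        cases e g (yes lt) = inj₂ (lt , e , g)
        cases e g (no ≮)   = inj₁ (e , good-skip u v v≡u σ g (ℕ.≮⇒≥ ≮))

    private
      module _ {t : ℕ} (u≡1+t : u ≡ suc t) where

        v≡1+t : toℕ v ≡ suc t
        v≡1+t = ≡.trans v≡u u≡1+t

        from-v : ∀ p (τ : Permutation′ n) → toℕ (insert p v τ ⟨$⟩ˡ v) ≡ toℕ p
        from-v p τ = ≡.cong toℕ (≡.trans (≡.cong (insert p v τ ⟨$⟩ˡ_) (≡.sym (insert-at p v τ))) (inverseˡ (insert p v τ)))

        module _ (p : Fin (suc n)) (τ : Permutation′ n) (p≤t : toℕ p ≤ t) (g : Good t (suc t) τ) where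

          left : ∀ i → toℕ i < toℕ p → toℕ v ≤ val τ i
          left i i<p = ℕ.≤-trans (ℕ.≤-reflexive v≡1+t) (g .proj₁ i (ℕ.<-≤-trans i<p p≤t))

          exc-eq : exc (insert p v τ) ≡ suc (exc τ)
          exc-eq = ≡.trans
            (exc-insert p v τ left
              (λ i i<p → ℕ.<-≤-trans (ℕ.<-≤-trans i<p (ℕ.≤-trans p≤t (ℕ.n≤1+n t))) (g .proj₁ i (ℕ.<-≤-trans i<p p≤t)))
              (λ i τi<v → ℕ.≮⇒≥ λ i<τi → ℕ.<⇒≱ τi<v (ℕ.≤-trans (ℕ.≤-reflexive v≡1+t)
                (g .proj₁ i (ℕ.<-≤-trans i<τi (ℕ.≤-pred (≡.subst (val τ i <_) v≡1+t τi<v)))))))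
            (≡.cong (_+ exc τ) (𝟙-yes (toℕ p <? toℕ v) (ℕ.≤-trans (s≤s p≤t) (ℕ.≤-reflexive (≡.sym v≡1+t)))))

          -- The value t + 1 at position p adds t + 1 + p inversions, one of which is offset by the
          -- new excedance.
          weight-eq : weight (insert p v τ) ≋ q ^ (t + toℕ p) ⊗ weight τ
          weight-eq = trans (^-congʳ q eq) (^-homo-* q (t + toℕ p) (inv-exc τ))
            where
            eq : inv-exc (insert p v τ) ≡ t + toℕ p + inv-exc τ
            eq = ≡.trans (≡.cong₂ _∸_ (inv-insert p v τ left) exc-eq)
              (≡.trans (≡.cong (λ a → a + toℕ p + inv τ ∸ suc (exc τ)) v≡1+t)
                (ℕ.+-∸-assoc (t + toℕ p) (exc≤inv τ)))

        fills-insert : ∀ k p τ → guard (fills? (suc k) (insert p v τ)) (weight (insert p v τ)) ≋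
          guard (toℕ p <? suc t) (q ^ (t + toℕ p)) ⊗ guard (goodExc? t (suc t) k τ) (weight τ)
        fills-insert k p τ with toℕ p <? suc t
        ... | no p≰t = trans (guard-no (fills? (suc k) (insert p v τ))
            λ (lt , _) → p≰t (≡.subst₂ _<_ (from-v p τ) u≡1+t lt))
          (sym (zeroˡ _))
        ... | yes (s≤s p≤t) = trans
          (guard-cong (fills? (suc k) (insert p v τ)) (goodExc? t (suc t) k τ)
            (λ (_ , e , g) → let g′ = remove-good g in ℕ.suc-injective (≡.trans (≡.sym (exc-eq p τ p≤t g′)) e) , g′)
            (λ (e , g) → ≡.subst₂ _<_ (≡.sym (from-v p τ)) (≡.sym u≡1+t) (s≤s p≤t)
                       , ≡.trans (exc-eq p τ p≤t g) (≡.cong suc e)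
                       , ≡.subst (λ x → Good x x (insert p v τ)) (≡.sym u≡1+t) (good-close-value⁻ p v τ v≡1+t p≤t g))
            (λ (_ , _ , g) → weight-eq p τ p≤t (remove-good g)))
          (guard-⊗ (goodExc? t (suc t) k τ) _ _)
          where
          remove-good : Good u u (insert p v τ) → Good t (suc t) τ
          remove-good g = good-close-value p v τ v≡1+t p≤t (≡.subst (λ x → Good x x (insert p v τ)) u≡1+t g)

        filling : ∀ k → ∑ (perms (suc n)) (λ σ → guard (fills? (suc k) σ) (weight σ)) ≋ w t ⊗ GoodSum t (suc t) n k
        filling k = begin
          ∑ (perms (suc n)) (λ σ → guard (fills? (suc k) σ) (weight σ))
            ≈⟨ ∑-insert-value v _ (λ {σ} {τ} → fills-cong (suc k) {σ} {τ}) ⟩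
          ∑ (allFin (suc n)) (λ p → ∑ (perms n) (λ τ → guard (fills? (suc k) (insert p v τ)) (weight (insert p v τ))))
            ≈⟨ ∑-cong (λ p → trans (∑-cong (fills-insert k p) (perms n))
                 (∑-⊗ˡ (guard (toℕ p <? suc t) (q ^ (t + toℕ p))) (λ τ → guard (goodExc? t (suc t) k τ) (weight τ)) (perms n)))
                   (allFin (suc n)) ⟩
          ∑ (allFin (suc n)) (λ p → guard (toℕ p <? suc t) (q ^ (t + toℕ p)) ⊗ GoodSum t (suc t) n k)
            ≈⟨ ∑-⊗ʳ (GoodSum t (suc t) n k) (λ p → guard (toℕ p <? suc t) (q ^ (t + toℕ p))) (allFin (suc n)) ⟩
          ∑ (allFin (suc n)) (λ p → guard (toℕ p <? suc t) (q ^ (t + toℕ p))) ⊗ GoodSum t (suc t) n k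
            ≈⟨ *-congʳ (∑-guard-< (ℕ.m≤n⇒m≤1+n (≡.subst (_≤ n) u≡1+t u≤n)) (t +_) (q ^_)) ⟩
          w t ⊗ GoodSum t (suc t) n k ∎

        not-filling : ∑ (perms (suc n)) (λ σ → guard (fills? 0 σ) (weight σ)) ≋ 0#
        not-filling = trans (∑-insert-value v _ (λ {σ} {τ} → fills-cong 0 {σ} {τ}))
          (trans (∑-cong (λ p → trans (∑-cong (λ τ → guard-no (fills? 0 (insert p v τ)) (no-exc p τ)) (perms n))
            (∑-0 (perms n)))
            (allFin (suc n))) (∑-0 (allFin (suc n))))
          where
          no-exc : ∀ p τ → ¬ (toℕ (insert p v τ ⟨$⟩ˡ v) < u × exc (insert p v τ) ≡ 0 × Good u u (insert p v τ))
          no-exc p τ (lt , e , g) with p≤t ← ℕ.≤-pred (≡.subst₂ _<_ (from-v p τ) u≡1+t lt)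
            with ≡.trans (≡.sym (exc-eq p τ p≤t
              (good-close-value p v τ v≡1+t p≤t (≡.subst (λ x → Good x x (insert p v τ)) u≡1+t g)))) e
          ... | ()

    -- Either value u lies at an unread position, or at one of the u = t + 1 open positions p = 0,
    -- ..., t. The latter completes an excedance, and the factors q^(t+p) add up to `w t`.
    GoodSum-value : ∀ k → GoodSum u u (suc n) k ≋
      GoodSum u (suc u) (suc n) k ⊕ down (λ t k → w t ⊗ GoodSum t (suc t) n k) u k
    GoodSum-value k = trans (GoodSum-split k) (+-congˡ (last u ≡.refl k))
      where
      -- A copy of u is matched on, because `v` and `fills?` depend on u itself.
      last : ∀ u′ → u ≡ u′ → ∀ k → ∑ (perms (suc n)) (λ σ → guard (fills? k σ) (weight σ)) ≋
        down (λ t k → w t ⊗ GoodSum t (suc t) n k) u′ k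
      last zero    eq k       = trans
        (∑-cong (λ σ → guard-no (fills? k σ) λ (lt , _) → ℕ.n≮0 (≡.subst (toℕ (σ ⟨$⟩ˡ v) <_) eq lt)) (perms (suc n)))
        (∑-0 (perms (suc n)))
      last (suc t) eq zero    = not-filling eq
      last (suc t) eq (suc k) = filling eq k

  -- Weighted Motzkin paths and the excedance side.

  -- motzkin m u k is the sum over the paths from height u to 0 with m + 1 steps, k
  -- of them down besides the last one, which leaves height 0.
  motzkin : ℕ → ℕ → ℕ → Carrier
  motzkin zero    zero    zero    = 1#
  motzkin zero    zero    (suc k) = 0#
  motzkin zero    (suc u) k       = 0#
  motzkin (suc m) u       k       = w u ⊗ (motzkin m (suc u) k ⊕ (motzkin m u k ⊕ down (motzkin m) u k))

  -- On the excedance side an up step weighs 1 and a down step from u + 1 weighs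
  -- w (u + 1) w u, so the u pending down steps carry the extra factor openings u.
  openings : ℕ → Carrier
  openings zero    = 1#
  openings (suc u) = w u ⊗ openings u

  -- `n` counts the u open positions and m + 1 unread ones: an up step keeps n, a level step removes
  -- one pair, a down step two. For m = 0 an open position would need a value at least n, so u = 0
  -- remains, with weight q^0 = 1, which is also the value of `w 0` for the last step.
  goodSum-motzkin : ∀ m u n k → n ≡ u + suc m → GoodSum u (suc u) n k ≋ openings u ⊗ motzkin m u k
  goodSum-motzkin zero zero .1 zero    ≡.refl = trans (+-identityʳ _) (sym (*-identityˡ 1#))
  goodSum-motzkin zero zero .1 (suc k) ≡.refl = trans (+-identityʳ _) (sym (zeroʳ 1#))
  goodSum-motzkin zero (suc u) n k eq = trans
    (∑-cong (λ σ → guard-no (goodExc? (suc u) (suc (suc u)) k σ) (impossible σ)) (perms n))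
    (trans (∑-0 (perms n)) (sym (zeroʳ _)))
    where
    n≡2+u : n ≡ suc (suc u)
    n≡2+u = ≡.trans eq (ℕ.+-comm (suc u) 1)
    impossible : ∀ σ → ¬ (exc σ ≡ k × Good (suc u) (suc (suc u)) σ)
    impossible σ (_ , high , _) = ℕ.<⇒≱ (Fin.toℕ<n (σ ⟨$⟩ʳ i)) (ℕ.≤-trans (ℕ.≤-reflexive n≡2+u)
      (high i (ℕ.≤-trans (s≤s (ℕ.≤-reflexive (Fin.toℕ-fromℕ< _))) (s≤s z≤n))))
      where
      i : Fin n
      i = fromℕ< {0} (≡.subst (0 <_) (≡.sym n≡2+u) (s≤s z≤n))
  goodSum-motzkin (suc m) u (suc (suc n)) k eq = begin
    GoodSum u (suc u) (suc (suc n)) k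
      ≈⟨ GoodSum-position (ℕ.m≤n⇒m≤1+n u≤n) ⟩
    GoodSum (suc u) (suc (suc u)) (suc (suc n)) k ⊕ w u ⊗ GoodSum u u (suc n) k
      ≈⟨ +-cong (goodSum-motzkin m (suc u) (suc (suc n)) k (≡.trans eq (ℕ.+-suc u (suc m))))
           (*-congˡ (trans (GoodSum-value u≤n k) (+-cong (goodSum-motzkin m u (suc n) k eq′) (lower u k eq′)))) ⟩
    (w u ⊗ openings u) ⊗ motzkin m (suc u) k ⊕ w u ⊗ (openings u ⊗ motzkin m u k ⊕ openings u ⊗ down (motzkin m) u k)
      ≈⟨ rearrange (w u) (openings u) _ _ _ ⟩
    openings u ⊗ motzkin (suc m) u k ∎
    where
    eq′ : suc n ≡ u + suc m
    eq′ = ℕ.suc-injective (≡.trans eq (ℕ.+-suc u (suc m)))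
    u≤n : u ≤ n
    u≤n = ≡.subst (u ≤_) (≡.sym (ℕ.suc-injective (≡.trans eq′ (ℕ.+-suc u m)))) (ℕ.m≤m+n u m)
    lower : ∀ u k → suc n ≡ u + suc m → down (λ t k → w t ⊗ GoodSum t (suc t) n k) u k ≋ openings u ⊗ down (motzkin m) u k
    lower zero    k       _  = sym (zeroʳ _)
    lower (suc t) zero    _  = sym (zeroʳ _)
    lower (suc t) (suc k) eq = trans (*-congˡ (goodSum-motzkin m t n k (ℕ.suc-injective eq))) (sym (*-assoc _ _ _))
    rearrange : ∀ a b x y z → (a ⊗ b) ⊗ x ⊕ a ⊗ (b ⊗ y ⊕ b ⊗ z) ≋ b ⊗ (a ⊗ (x ⊕ (y ⊕ z)))
    rearrange a b x y z = begin
      (a ⊗ b) ⊗ x ⊕ a ⊗ (b ⊗ y ⊕ b ⊗ z)     ≈⟨ +-cong (*-assoc a b x) (*-congˡ (sym (distribˡ b y z))) ⟩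
      a ⊗ (b ⊗ x) ⊕ a ⊗ (b ⊗ (y ⊕ z))       ≈⟨ distribˡ a _ _ ⟨
      a ⊗ (b ⊗ x ⊕ b ⊗ (y ⊕ z))             ≈⟨ *-congˡ (distribˡ b x (y ⊕ z)) ⟨
      a ⊗ (b ⊗ (x ⊕ (y ⊕ z)))               ≈⟨ *-assoc a b _ ⟨
      (a ⊗ b) ⊗ (x ⊕ (y ⊕ z))               ≈⟨ *-congʳ (*-comm a b) ⟩
      (b ⊗ a) ⊗ (x ⊕ (y ⊕ z))               ≈⟨ *-assoc b a _ ⟩
      b ⊗ (a ⊗ (x ⊕ (y ⊕ z)))               ∎
  goodSum-motzkin (suc m) zero    zero       k ()
  goodSum-motzkin (suc m) (suc u) zero       k ()
  goodSum-motzkin (suc m) zero    (suc zero) k ()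
  goodSum-motzkin (suc m) (suc u) (suc zero) k eq = contradiction (≡.trans (ℕ.suc-injective eq) (ℕ.+-suc u (suc m))) λ ()

  -- The recurrence for sums over cut words.

  cutsFrom : ∀ {m} → ℕ → Vec ℕ m → List Cut
  cutsFrom a []      = letter a ∷ []
  cutsFrom a (b ∷ v) = map (a ▹_) (cutsFrom b v) ++ map (a ∣_) (cutsFrom b v)

  cuts : ∀ {m} → Vec ℕ (suc m) → List Cut
  cuts (a ∷ v) = cutsFrom a v

  ∑-cutsFrom : ∀ {m} a b (v : Vec ℕ m) f →
    ∑ (cutsFrom a (b ∷ v)) f ≋ ∑ (cutsFrom b v) (λ c → f (a ▹ c) ⊕ f (a ∣ c))
  ∑-cutsFrom a b v f = begin
    ∑ (map (a ▹_) (cutsFrom b v) ++ map (a ∣_) (cutsFrom b v)) f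
      ≈⟨ ∑-++ f (map (a ▹_) (cutsFrom b v)) _ ⟩
    ∑ (map (a ▹_) (cutsFrom b v)) f ⊕ ∑ (map (a ∣_) (cutsFrom b v)) f
      ≈⟨ +-cong (∑-map f (a ▹_) (cutsFrom b v)) (∑-map f (a ∣_) (cutsFrom b v)) ⟩
    ∑ (cutsFrom b v) (f ∘ (a ▹_)) ⊕ ∑ (cutsFrom b v) (f ∘ (a ∣_))
      ≈⟨ ∑-⊕ (f ∘ (a ▹_)) (f ∘ (a ∣_)) (cutsFrom b v) ⟨
    ∑ (cutsFrom b v) (λ c → f (a ▹ c) ⊕ f (a ∣ c)) ∎

  cuts-above : ∀ {y m} a (v : Vec ℕ m) → y < a → Vec.All (y <_) v → All (Above y) (cutsFrom a v)
  cuts-above a []      y<a []         = y<a ∷ []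
  cuts-above a (b ∷ v) y<a (y<b ∷ y<) = All.++⁺
    (All.map⁺ (All.map (y<a ,_) (cuts-above b v y<b y<)))
    (All.map⁺ (All.map (y<a ,_) (cuts-above b v y<b y<)))

  module _ (y : ℕ) where

    innerSum : Cut → (Cut → Carrier) → Carrier
    innerSum c f = (∑ (valleys y c) f ⊕ ∑ (innerAscents y c) f) ⊕ (∑ (descents y c) f ⊕ ∑ (innerPeaks y c) f)

    innerSum-▹ : ∀ a c f → innerSum (a ▹ c) f ≋ innerSum c (f ∘ (a ▹_))
    innerSum-▹ a c f = +-cong
      (+-cong (∑-map f (a ▹_) (valleys y c)) (∑-map f (a ▹_) (innerAscents y c)))
      (+-cong (∑-map f (a ▹_) (descents y c)) (∑-map f (a ▹_) (innerPeaks y c)))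

    innerSum-∣ : ∀ a c f → innerSum (a ∣ c) f ≋
      ((f (a ▹ y ▹ c) ⊕ f (a ∣ y ▹ c)) ⊕ (f (a ▹ y ∣ c) ⊕ f (a ∣ y ∣ c))) ⊕ innerSum c (f ∘ (a ∣_))
    innerSum-∣ a c f = trans
      (+-cong
        (trans (+-cong (+-congˡ (∑-map f (a ∣_) (valleys y c))) (+-congˡ (∑-map f (a ∣_) (innerAscents y c))))
          (interchange _ _ _ _))
        (trans (+-cong (+-congˡ (∑-map f (a ∣_) (descents y c))) (+-congˡ (∑-map f (a ∣_) (innerPeaks y c))))
          (interchange _ _ _ _)))
      (interchange _ _ _ _)

    -- Erasing y from a cut word leaves a bar in its gap, whatever the two junctions around y were.
    -- The four words with y right after `a` therefore all come from `a ∣ c`, one in each of the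
    -- four lists, and none comes from the gap of `a ▹ c`.
    ∑-insertAt-inner : ∀ {m} a (v : Vec ℕ m) f →
      ∑ (allFin (suc m)) (λ p → ∑ (cutsFrom a (insertAt v p y)) f) ≋ ∑ (cutsFrom a v) (λ c → innerSum c f)
    ∑-insertAt-inner a [] f = begin
      (f (a ▹ letter y) ⊕ (f (a ∣ letter y) ⊕ 0#)) ⊕ 0#
        ≈⟨ +-congʳ (trans (sym (+-assoc _ _ _)) (+-identityʳ _)) ⟩
      (f (a ▹ letter y) ⊕ f (a ∣ letter y)) ⊕ 0#
        ≈⟨ +-congʳ (trans (+-congʳ (+-identityʳ (0#))) (+-identityˡ _)) ⟨
      ((0# ⊕ 0#) ⊕ (f (a ▹ letter y) ⊕ f (a ∣ letter y))) ⊕ 0#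
        ≈⟨ +-congʳ (+-congˡ (+-cong (+-identityʳ _) (+-identityʳ _))) ⟨
      ((0# ⊕ 0#) ⊕ ((f (a ▹ letter y) ⊕ 0#) ⊕ (f (a ∣ letter y) ⊕ 0#))) ⊕ 0# ∎
    ∑-insertAt-inner {suc m} a (b ∷ v) f = begin
      ∑ (allFin (2 + m)) (λ p → ∑ (cutsFrom a (insertAt (b ∷ v) p y)) f)
        ≈⟨ ∑-allFin-suc (λ p → ∑ (cutsFrom a (insertAt (b ∷ v) p y)) f) ⟩
      ∑ (cutsFrom a (y ∷ b ∷ v)) f ⊕ ∑ (allFin (suc m)) (λ p → ∑ (cutsFrom a (b ∷ insertAt v p y)) f)
        ≈⟨ +-cong first-slot other-slots ⟩
      ∑ (cutsFrom b v) new ⊕ ∑ (cutsFrom b v) (λ c → innerSum c (λ c′ → f (a ▹ c′) ⊕ f (a ∣ c′)))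
        ≈⟨ ∑-⊕ new (λ c → innerSum c (λ c′ → f (a ▹ c′) ⊕ f (a ∣ c′))) (cutsFrom b v) ⟨
      ∑ (cutsFrom b v) (λ c → new c ⊕ innerSum c (λ c′ → f (a ▹ c′) ⊕ f (a ∣ c′)))
        ≈⟨ ∑-cong regroup (cutsFrom b v) ⟩
      ∑ (cutsFrom b v) (λ c → innerSum (a ▹ c) f ⊕ innerSum (a ∣ c) f)
        ≈⟨ ∑-cutsFrom a b v (λ c → innerSum c f) ⟨
      ∑ (cutsFrom a (b ∷ v)) (λ c → innerSum c f) ∎
      where
      new : Cut → Carrier
      new c = (f (a ▹ y ▹ c) ⊕ f (a ∣ y ▹ c)) ⊕ (f (a ▹ y ∣ c) ⊕ f (a ∣ y ∣ c))
      first-slot : ∑ (cutsFrom a (y ∷ b ∷ v)) f ≋ ∑ (cutsFrom b v) new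
      first-slot = trans (∑-cutsFrom a y (b ∷ v) f) (∑-cutsFrom y b v (λ c → f (a ▹ c) ⊕ f (a ∣ c)))
      other-slots : ∑ (allFin (suc m)) (λ p → ∑ (cutsFrom a (b ∷ insertAt v p y)) f) ≋
        ∑ (cutsFrom b v) (λ c → innerSum c (λ c′ → f (a ▹ c′) ⊕ f (a ∣ c′)))
      other-slots = trans (∑-cong (λ p → ∑-cutsFrom a b (insertAt v p y) f) (allFin (suc m)))
        (∑-insertAt-inner b v (λ c → f (a ▹ c) ⊕ f (a ∣ c)))
      innerSum-⊕ : ∀ c f g → innerSum c (λ c′ → f c′ ⊕ g c′) ≋ innerSum c f ⊕ innerSum c g
      innerSum-⊕ c f g = trans
        (+-cong
          (trans (+-cong (∑-⊕ f g (valleys y c)) (∑-⊕ f g (innerAscents y c))) (interchange _ _ _ _))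
          (trans (+-cong (∑-⊕ f g (descents y c)) (∑-⊕ f g (innerPeaks y c))) (interchange _ _ _ _)))
        (interchange _ _ _ _)
      regroup : ∀ c → new c ⊕ innerSum c (λ c′ → f (a ▹ c′) ⊕ f (a ∣ c′)) ≋ innerSum (a ▹ c) f ⊕ innerSum (a ∣ c) f
      regroup c = begin
        new c ⊕ innerSum c (λ c′ → f (a ▹ c′) ⊕ f (a ∣ c′))
          ≈⟨ +-congˡ (innerSum-⊕ c (f ∘ (a ▹_)) (f ∘ (a ∣_))) ⟩
        new c ⊕ (innerSum c (f ∘ (a ▹_)) ⊕ innerSum c (f ∘ (a ∣_)))
          ≈⟨ trans (sym (+-assoc _ _ _)) (trans (+-congʳ (+-comm _ _)) (+-assoc _ _ _)) ⟩
        innerSum c (f ∘ (a ▹_)) ⊕ (new c ⊕ innerSum c (f ∘ (a ∣_)))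
          ≈⟨ +-cong (innerSum-▹ a c f) (innerSum-∣ a c f) ⟨
        innerSum (a ▹ c) f ⊕ innerSum (a ∣ c) f ∎

    insertSum : Cut → (Cut → Carrier) → Carrier
    insertSum c f = (∑ (valleys y c) f ⊕ ∑ (ascendings y c) f) ⊕ (∑ (descents y c) f ⊕ ∑ (peaks y c) f)

    ∑-insertAt : ∀ {m} (v : Vec ℕ (suc m)) f →
      ∑ (allFin (2 + m)) (λ p → ∑ (cuts (insertAt v p y)) f) ≋ ∑ (cuts v) (λ c → insertSum c f)
    ∑-insertAt {m} (a ∷ v) f = begin
      ∑ (allFin (2 + m)) (λ p → ∑ (cuts (insertAt (a ∷ v) p y)) f)
        ≈⟨ ∑-allFin-suc (λ p → ∑ (cuts (insertAt (a ∷ v) p y)) f) ⟩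
      ∑ (cutsFrom y (a ∷ v)) f ⊕ ∑ (allFin (suc m)) (λ p → ∑ (cutsFrom a (insertAt v p y)) f)
        ≈⟨ +-cong (∑-cutsFrom y a v f) (∑-insertAt-inner a v f) ⟩
      ∑ (cutsFrom a v) (λ c → f (y ▹ c) ⊕ f (y ∣ c)) ⊕ ∑ (cutsFrom a v) (λ c → innerSum c f)
        ≈⟨ ∑-⊕ (λ c → f (y ▹ c) ⊕ f (y ∣ c)) (λ c → innerSum c f) (cutsFrom a v) ⟨
      ∑ (cutsFrom a v) (λ c → (f (y ▹ c) ⊕ f (y ∣ c)) ⊕ innerSum c f)
        ≈⟨ ∑-cong (λ c → trans (interchange _ _ _ _) (+-cong (swap _ _ _) (swap _ _ _))) (cutsFrom a v) ⟩
      ∑ (cutsFrom a v) (λ c → insertSum c f) ∎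
      where
      swap : ∀ r s t → r ⊕ (s ⊕ t) ≋ s ⊕ (r ⊕ t)
      swap r s t = trans (sym (+-assoc _ _ _)) (trans (+-congʳ (+-comm _ _)) (+-assoc _ _ _))

  fits? : ∀ h k c → Dec (bars c ≡ h × desᶜ c ≡ k × ddᶜ 0 c ≡ 0)
  fits? h k c = (bars c ≟ h) ×-dec (desᶜ c ≟ k) ×-dec (ddᶜ 0 c ≟ 0)

  cutWeight : ℕ → ℕ → Cut → Carrier
  cutWeight h k c = guard (fits? h k c) (q ^ stat c)

  -- `cutWeight h k c` vanishes unless `c` has h bars, so a factor depending on the bars may be
  -- evaluated at h.
  pin-bars : ∀ (f : ℕ → Carrier) h k c → f (bars c) ⊗ cutWeight h k c ≋ f h ⊗ cutWeight h k c
  pin-bars f h k c with bars c ≟ h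
  ... | yes ≡.refl = refl
  ... | no _       = trans (zeroʳ _) (sym (zeroʳ _))

  increments-applyUpTo : ∀ z → increments (suc z) ≡ applyUpTo (z +_) (suc z)
  increments-applyUpTo zero    = ≡.refl
  increments-applyUpTo (suc z) = ≡.cong₂ _∷_ (≡.sym (ℕ.+-identityʳ (suc z)))
    (≡.trans (≡.cong (map (2 +_)) (increments-applyUpTo z))
      (≡.trans (map-applyUpTo (z +_) (2 +_) (suc z)) (shift (suc z) (λ g → ≡.cong suc (≡.sym (ℕ.+-suc z g))))))
    where
    shift : ∀ n {f g : ℕ → ℕ} → (∀ i → f i ≡ g i) → applyUpTo f n ≡ applyUpTo g n
    shift zero    eq = ≡.refl
    shift (suc n) eq = ≡.cong₂ _∷_ (eq 0) (shift n (eq ∘ suc))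

  ∑-increments : ∀ z → ∑ (increments (suc z)) (q ^_) ≋ w z
  ∑-increments z = reflexive (≡.cong (λ is → ∑ is (q ^_)) (increments-applyUpTo z))

  module _ {y : ℕ} (0<y : 0 < y) {c : Cut} (ab : Above y c) where

    private
      ∑-extensions : ∀ {e δ cs is h k h′ k′} → e + h ≡ δ + h′ → k ≡ δ + k′ →
        Pointwise (Extends₀ 0<y e δ c) cs is → ∑ cs (cutWeight h k) ≋ ∑ is (q ^_) ⊗ cutWeight h′ k′ c
      ∑-extensions _ _ [] = sym (zeroˡ _)
      ∑-extensions {e} {δ} {c′ ∷ _} {i ∷ _} {h} {k} {h′} {k′} eqʰ eqᵏ (E ∷ Es) = trans
        (+-cong head (∑-extensions {e} {δ} eqʰ eqᵏ Es)) (sym (distribʳ _ _ _))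
        where
        open Extends₀ E
        head : cutWeight h k c′ ≋ (q ^ i) ⊗ cutWeight h′ k′ c
        head = trans
          (guard-cong (fits? h k c′) (fits? h′ k′ c)
            (λ (b , d , n) → ℕ.+-cancelˡ-≡ δ _ _ (≡.trans (≡.sym bars-eq) (≡.trans (≡.cong (e +_) b) eqʰ))
                           , ℕ.+-cancelˡ-≡ δ _ _ (≡.trans (≡.sym des-eq) (≡.trans d eqᵏ)) , ≡.trans (≡.sym dd-eq) n)
            (λ (b , d , n) → ℕ.+-cancelˡ-≡ e _ _ (≡.trans bars-eq (≡.trans (≡.cong (δ +_) b) (≡.sym eqʰ)))
                           , ≡.trans des-eq (≡.trans (≡.cong (δ +_) d) (≡.sym eqᵏ)) , ≡.trans dd-eq n)
            (λ _ → trans (^-congʳ q stat-eq) (^-homo-* q i (stat c))))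
          (guard-⊗ (fits? h′ k′ c) (q ^ i) (q ^ stat c))

      ∑-peaks : ∀ h k → ∑ (peaks y c) (cutWeight h k) ≋ w h ⊗ down (λ h k → cutWeight h k c) h k
      ∑-peaks zero k = trans (vanish (peaks-extend 0<y c ab)) (sym (zeroʳ _))
        where
        vanish : ∀ {cs is} → Pointwise (Extends₀ 0<y 0 1 c) cs is → ∑ cs (cutWeight zero k) ≋ 0#
        vanish [] = refl
        vanish {c′ ∷ _} (E ∷ Es) = trans (+-cong
          (guard-no (fits? zero k c′) λ (b , _) → ℕ.1+n≢0 (≡.trans (≡.sym (Extends₀.bars-eq E)) b))
            (vanish Es)) (+-identityˡ _)
      ∑-peaks (suc h) zero = trans (vanish (peaks-extend 0<y c ab)) (sym (zeroʳ _))
        where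
        vanish : ∀ {cs is} → Pointwise (Extends₀ 0<y 0 1 c) cs is → ∑ cs (cutWeight (suc h) zero) ≋ 0#
        vanish [] = refl
        vanish {c′ ∷ _} (E ∷ Es) = trans (+-cong
          (guard-no (fits? (suc h) zero c′) λ (_ , d , _) → ℕ.1+n≢0 (≡.trans (≡.sym (Extends₀.des-eq E)) d))
            (vanish Es)) (+-identityˡ _)
      ∑-peaks (suc h) (suc k) = begin
        ∑ (peaks y c) (cutWeight (suc h) (suc k))
          ≈⟨ ∑-extensions {0} {1} ≡.refl ≡.refl (peaks-extend 0<y c ab) ⟩
        ∑ (increments (2 + bars c)) (q ^_) ⊗ cutWeight h k c
          ≈⟨ pin-bars (λ b → ∑ (increments (2 + b)) (q ^_)) h k c ⟩
        ∑ (increments (2 + h)) (q ^_) ⊗ cutWeight h k c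
          ≈⟨ *-congʳ (∑-increments (suc h)) ⟩
        w (suc h) ⊗ cutWeight h k c ∎

    -- If the result has h bars, then `c` had h + 1, h or h - 1 of them, for a valley, a double
    -- ascent or a peak. In each case there are h + 1 places with increments h, ..., 2h, so the
    -- factor is always `w h`.
    insertSum-cutWeight : ∀ h k → insertSum y c (cutWeight h k) ≋
      w h ⊗ (cutWeight (suc h) k c ⊕ (cutWeight h k c ⊕ down (λ h k → cutWeight h k c) h k))
    insertSum-cutWeight h k = begin
      insertSum y c (cutWeight h k)
        ≈⟨ +-cong (+-cong up level) (trans (+-cong no-descents (∑-peaks h k)) (+-identityˡ _)) ⟩
      (w h ⊗ cutWeight (suc h) k c ⊕ w h ⊗ cutWeight h k c) ⊕ w h ⊗ down (λ h k → cutWeight h k c) h k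
        ≈⟨ +-assoc _ _ _ ⟩
      w h ⊗ cutWeight (suc h) k c ⊕ (w h ⊗ cutWeight h k c ⊕ w h ⊗ down (λ h k → cutWeight h k c) h k)
        ≈⟨ trans (distribˡ _ _ _) (+-congˡ (distribˡ _ _ _)) ⟨
      w h ⊗ (cutWeight (suc h) k c ⊕ (cutWeight h k c ⊕ down (λ h k → cutWeight h k c) h k)) ∎
      where
      up : ∑ (valleys y c) (cutWeight h k) ≋ w h ⊗ cutWeight (suc h) k c
      up = trans (∑-extensions {1} {0} ≡.refl ≡.refl (Pointwise.map Extends.extends₀ (valleys-extend 0<y c ab)))
        (trans (pin-bars (λ b → ∑ (increments b) (q ^_)) (suc h) k c) (*-congʳ (∑-increments h)))
      level : ∑ (ascendings y c) (cutWeight h k) ≋ w h ⊗ cutWeight h k c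
      level = trans (∑-extensions {0} {0} ≡.refl ≡.refl (ascendings-extend 0<y c ab))
        (trans (pin-bars (λ b → ∑ (increments (suc b)) (q ^_)) h k c) (*-congʳ (∑-increments h)))
      no-descents : ∑ (descents y c) (cutWeight h k) ≋ 0#
      no-descents = trans
        (∑-congᴬ (All.map (λ {c′} dd≥1 → guard-no (fits? h k c′) λ (_ , _ , dd≡0) → ℕ.n≮0 (≡.subst (0 <_) dd≡0 (dd≥1 0)))
          (descents-dd c ab)))
        (∑-0 (descents y c))

  tabulate-insertAt : ∀ {n} (f : Fin n → ℕ) (g : Fin (suc n) → ℕ) p {y} →
    g p ≡ y → (∀ i → g (punchIn p i) ≡ f i) → Vec.tabulate g ≡ insertAt (Vec.tabulate f) p y
  tabulate-insertAt f g zero            gp≡y eq = ≡.cong₂ _∷_ gp≡y (tabulate-cong eq)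
  tabulate-insertAt {suc n} f g (suc p) gp≡y eq =
    ≡.cong₂ _∷_ (eq zero) (tabulate-insertAt (f ∘ suc) (g ∘ suc) p gp≡y (eq ∘ suc))

  -- The offset `x` leaves room for x smaller letters. Removing the smallest letter raises the
  -- offset, so the remaining letters are not renumbered.
  letters : ∀ {n} → ℕ → Permutation′ n → Vec ℕ n
  letters x τ = Vec.tabulate (λ i → suc (x + val τ i))

  letters-insert : ∀ {n} x p (τ : Permutation′ n) → letters x (insert p zero τ) ≡ insertAt (letters (suc x) τ) p (suc x)
  letters-insert x p τ = tabulate-insertAt (λ i → suc (suc x + val τ i)) (λ i → suc (x + val (insert p zero τ) i)) p
    (≡.trans (≡.cong (λ a → suc (x + a)) (val-at p zero τ)) (≡.cong suc (ℕ.+-identityʳ x)))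
    (λ i → ≡.trans (≡.cong (λ a → suc (x + a)) (PunchIn-above (val-punchIn p zero τ i) z≤n))
      (≡.cong suc (ℕ.+-suc x (val τ i))))

  cuts-letters-above : ∀ {m} x (τ : Permutation′ (suc m)) → All (Above (suc x)) (cuts (letters (suc x) τ))
  cuts-letters-above x τ = cuts-above _ (Vec.tabulate (λ i → suc (suc x + val τ (suc i))))
    (above-x zero) (tabulate⁺ (above-x ∘ suc))
    where
    above-x : ∀ i → suc x < suc (suc x + val τ i)
    above-x i = s≤s (s≤s (ℕ.m≤m+n x (val τ i)))

  CutSum : ℕ → ℕ → ℕ → ℕ → Carrier
  CutSum x m h k = ∑ (perms (suc m)) (λ τ → ∑ (cuts (letters x τ)) (cutWeight h k))

  down-∑ : ∀ {a} {A : Set a} (f : A → ℕ → ℕ → Carrier) xs h k →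
    ∑ xs (λ x → down (f x) h k) ≋ down (λ h k → ∑ xs (λ x → f x h k)) h k
  down-∑ f xs zero    k       = ∑-0 xs
  down-∑ f xs (suc h) zero    = ∑-0 xs
  down-∑ f xs (suc h) (suc k) = refl

  down-cong : ∀ {f g} → (∀ h k → f h k ≋ g h k) → ∀ h k → down f h k ≋ down g h k
  down-cong eq zero    k       = refl
  down-cong eq (suc h) zero    = refl
  down-cong eq (suc h) (suc k) = eq h k

  ∑-down : ∀ {a} {A : Set a} (f : A → ℕ → ℕ → Carrier) r xs h k →
    ∑ xs (λ x → r ⊗ (f x (suc h) k ⊕ (f x h k ⊕ down (f x) h k))) ≋
    r ⊗ (∑ xs (λ x → f x (suc h) k) ⊕ (∑ xs (λ x → f x h k) ⊕ down (λ h k → ∑ xs (λ x → f x h k)) h k))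
  ∑-down f r xs h k = trans (∑-⊗ˡ r _ xs) (*-congˡ (trans (∑-⊕ (λ x → f x (suc h) k) _ xs)
    (+-congˡ (trans (∑-⊕ (λ x → f x h k) _ xs) (+-congˡ (down-∑ f xs h k))))))

  CutSum-suc : ∀ x m h k → CutSum x (suc m) h k ≋
    w h ⊗ (CutSum (suc x) m (suc h) k ⊕ (CutSum (suc x) m h k ⊕ down (CutSum (suc x) m) h k))
  CutSum-suc x m h k = begin
    CutSum x (suc m) h k
      ≈⟨ ∑-insert-value {suc m} zero (λ τ → ∑ (cuts (letters x τ)) (cutWeight h k))
        (λ {σ} {τ} σ≈τ → reflexive (≡.cong (λ v → ∑ (cuts v) (cutWeight h k))
           (tabulate-cong λ i → ≡.cong (λ a → suc (x + a)) (val-cong {σ = σ} {τ} σ≈τ i)))) ⟩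
    ∑ (allFin (2 + m)) (λ p → ∑ (perms (suc m)) (λ τ → ∑ (cuts (letters x (insert p zero τ))) (cutWeight h k)))
      ≈⟨ ∑-comm (λ p τ → ∑ (cuts (letters x (insert p zero τ))) (cutWeight h k)) (allFin (2 + m)) (perms (suc m)) ⟩
    ∑ (perms (suc m)) (λ τ → ∑ (allFin (2 + m)) (λ p → ∑ (cuts (letters x (insert p zero τ))) (cutWeight h k)))
      ≈⟨ ∑-cong step (perms (suc m)) ⟩
    ∑ (perms (suc m)) (λ τ → w h ⊗ (total τ (suc h) k ⊕ (total τ h k ⊕ down (total τ) h k)))
      ≈⟨ ∑-down total (w h) (perms (suc m)) h k ⟩
    w h ⊗ (CutSum (suc x) m (suc h) k ⊕ (CutSum (suc x) m h k ⊕ down (CutSum (suc x) m) h k)) ∎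
    where
    total : Permutation′ (suc m) → ℕ → ℕ → Carrier
    total τ h k = ∑ (cuts (letters (suc x) τ)) (cutWeight h k)
    step : ∀ τ → ∑ (allFin (2 + m)) (λ p → ∑ (cuts (letters x (insert p zero τ))) (cutWeight h k)) ≋
      w h ⊗ (total τ (suc h) k ⊕ (total τ h k ⊕ down (total τ) h k))
    step τ = begin
      ∑ (allFin (2 + m)) (λ p → ∑ (cuts (letters x (insert p zero τ))) (cutWeight h k))
        ≈⟨ ∑-cong (λ p → reflexive (≡.cong (λ v → ∑ (cuts v) (cutWeight h k)) (letters-insert x p τ))) (allFin (2 + m)) ⟩
      ∑ (allFin (2 + m)) (λ p → ∑ (cuts (insertAt (letters (suc x) τ) p (suc x))) (cutWeight h k))
        ≈⟨ ∑-insertAt (suc x) (letters (suc x) τ) (cutWeight h k) ⟩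
      ∑ (cuts (letters (suc x) τ)) (λ c → insertSum (suc x) c (cutWeight h k))
        ≈⟨ ∑-congᴬ (All.map (λ ab → insertSum-cutWeight (s≤s z≤n) ab h k) (cuts-letters-above x τ)) ⟩
      ∑ (cuts (letters (suc x) τ))
        (λ c → w h ⊗ (cutWeight (suc h) k c ⊕ (cutWeight h k c ⊕ down (λ h k → cutWeight h k c) h k)))
        ≈⟨ ∑-down (λ c h k → cutWeight h k c) (w h) (cuts (letters (suc x) τ)) h k ⟩
      w h ⊗ (total τ (suc h) k ⊕ (total τ h k ⊕ down (total τ) h k)) ∎

  CutSum-motzkin : ∀ m x h k → CutSum x m h k ≋ motzkin m h k
  CutSum-motzkin zero    x zero    zero    = trans (+-identityʳ _) (+-identityʳ _)
  CutSum-motzkin zero    x zero    (suc k) = trans (+-identityʳ _) (+-identityʳ _)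
  CutSum-motzkin zero    x (suc h) k       = trans (+-identityʳ _) (+-identityʳ _)
  CutSum-motzkin (suc m) x h       k       = trans (CutSum-suc x m h k) (*-congˡ (+-cong (CutSum-motzkin m (suc x) (suc h) k)
    (+-cong (CutSum-motzkin m (suc x) h k) (down-cong (CutSum-motzkin m (suc x)) h k))))

  -- From cut words and scan states back to the enumerators.

  ∑-cuts-run : ∀ m t f → (∀ c → bars c ≢ 0 → f c ≋ 0#) →
    ∑ (cuts (Vec.tabulate {n = suc m} (λ i → t (toℕ i)))) f ≋ f (run t m)
  ∑-cuts-run zero    t f vanish = +-identityʳ _
  ∑-cuts-run (suc m) t f vanish = trans (∑-cutsFrom (t 0) (t 1) rest f)
    (trans (∑-cong {f = λ c → f (t 0 ▹ c) ⊕ f (t 0 ∣ c)} {f ∘ (t 0 ▹_)}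
      (λ c → trans (+-congˡ (vanish (t 0 ∣ c) λ ())) (+-identityʳ _)) (cutsFrom (t 1) rest))
      (∑-cuts-run m (t ∘ suc) (f ∘ (t 0 ▹_)) (λ c → vanish (t 0 ▹ c))))
    where
    rest : Vec ℕ m
    rest = Vec.tabulate (λ i → t (2 + toℕ i))

  γ-motzkin : ∀ m k → γ (suc m) k ≋ motzkin m 0 k
  γ-motzkin m k = begin
    γ (suc m) k
      ≈⟨ ∑-filter (λ σ → (des σ ≟ k) ×-dec (dd σ ≟ 0)) _ (perms (suc m)) ⟩
    ∑ (perms (suc m)) (λ σ → guard ((des σ ≟ k) ×-dec (dd σ ≟ 0)) (q ^ (2 * pat31-2 σ + pat2-13 σ)))
      ≈⟨ ∑-cong step (perms (suc m)) ⟩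
    CutSum 0 m 0 k
      ≈⟨ CutSum-motzkin m 0 0 k ⟩
    motzkin m 0 k ∎
    where
    step : ∀ σ → guard ((des σ ≟ k) ×-dec (dd σ ≟ 0)) (q ^ (2 * pat31-2 σ + pat2-13 σ)) ≋
      ∑ (cuts (letters 0 σ)) (cutWeight 0 k)
    step σ = begin
      guard ((des σ ≟ k) ×-dec (dd σ ≟ 0)) (q ^ (2 * pat31-2 σ + pat2-13 σ))
        ≈⟨ guard-cong ((des σ ≟ k) ×-dec (dd σ ≟ 0)) (fits? 0 k (run t m))
             (λ (d , n) → bars-run t m , ≡.trans (≡.sym (des≡ σ)) d , ≡.trans (≡.sym (dd≡ σ)) n)
             (λ (_ , d , n) → ≡.trans (des≡ σ) d , ≡.trans (dd≡ σ) n)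
             (λ _ → ^-congʳ q (stat≡ σ)) ⟩
      cutWeight 0 k (run t m)
        -- At height 0 every cut word with a bar has weight 0, which leaves the plain word.
        ≈⟨ ∑-cuts-run m t (cutWeight 0 k) (λ c bars≢0 → guard-no (fits? 0 k c) (bars≢0 ∘ proj₁)) ⟨
      ∑ (cuts (Vec.tabulate {n = suc m} (λ i → t (toℕ i)))) (cutWeight 0 k)
        ≈⟨ reflexive (≡.cong (λ v → ∑ (cuts v) (cutWeight 0 k)) (tabulate-cong (word-suc σ))) ⟩
      ∑ (cuts (letters 0 σ)) (cutWeight 0 k) ∎
      where
      t : ℕ → ℕ
      t i = word σ (suc i)
      bars-run : ∀ t m → bars (run t m) ≡ 0
      bars-run t zero    = ≡.refl
      bars-run t (suc m) = bars-run (t ∘ suc) m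

  SDE-motzkin : ∀ m k → ∑q^ inv-exc (SDE (suc m) k) ≋ motzkin m 0 k
  SDE-motzkin m k = begin
    ∑q^ inv-exc (SDE (suc m) k)
      ≈⟨ ∑-filter (λ σ → (exc σ ≟ k) ×-dec (scda σ ≟ 0)) weight (perms (suc m)) ⟩
    ∑ (perms (suc m)) (λ σ → guard ((exc σ ≟ k) ×-dec (scda σ ≟ 0)) (weight σ))
      ≈⟨ ∑-cong (λ σ → guard-cong ((exc σ ≟ k) ×-dec (scda σ ≟ 0)) (goodExc? 0 1 k σ)
           (λ (e , s) → e , scda≡0⇒good σ s) (λ (e , g) → e , good⇒scda≡0 σ g) (λ _ → refl)) (perms (suc m)) ⟩
    GoodSum 0 1 (suc m) k
      ≈⟨ goodSum-motzkin m 0 (suc m) k ≡.refl ⟩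
    1# ⊗ motzkin m 0 k
      ≈⟨ *-identityˡ _ ⟩
    motzkin m 0 k ∎

theorem2p10 : ∀ {c ℓ} (R : CommutativeSemiring c ℓ) (q : CommutativeSemiring.Carrier R) →
  let open CommutativeSemiring R using (_≈_)
      open Enumerators R q
  in (n k : ℕ) → 2 * k < n →
     (γ n k ≈ ∑q^ inv-exc (DE* n k)) × (∑q^ inv-exc (DE* n k) ≈ ∑q^ inv-exc (SDE n k))
theorem2p10 R q (ℕ.suc m) k _ =
  trans (γ-motzkin m k) (sym (trans DE*≈SDE (SDE-motzkin m k))) , DE*≈SDE
  where
  open CommutativeSemiring R using (_≈_; reflexive; sym; trans)
  open Enumerators R q
  open Expansion R q using (γ-motzkin; SDE-motzkin)
  DE*≈SDE : ∑q^ inv-exc (DE* (ℕ.suc m) k) ≈ ∑q^ inv-exc (SDE (ℕ.suc m) k)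
  DE*≈SDE = reflexive (cong (∑q^ inv-exc) (Permutations.DE*≡SDE (ℕ.suc m) k))
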